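{- Let $m,n\ge 0$ be integers with $2m+n\ge 1$ and $(m,n)\neq(0,1)$, and let $\Delta\ge 0$ be an integer. Let $\mathcal{G}_\Delta$ be the family of graphs of maximum degree at most $\Delta$, and let $\nu(2,\Delta)$ be the maximum number of vertices of a graph of diameter at most $2$ and maximum degree at most $\Delta$. Then: (i) if $\Delta<2m+n$, then $\nu(2,\Delta)=\omega_{a(m,n)}(\mathcal{G}_\Delta)\le\omega_{r(m,n)}(\mathcal{G}_\Delta)\le\Delta^2+1$; (ii) if $\Delta=2m+n$, then $\omega_{a(m,n)}(\mathcal{G}_\Delta)\le\omega_{r(m,n)}(\mathcal{G}_\Delta)\le\Delta^2+1$; (iii) if $\Delta>2m+n$, then $\omega_{a(m,n)}(\mathcal{G}_\Delta)\le\omega_{r(m,n)}(\mathcal{G}_\Delta)\le\left\lfloor\frac{2m+n-1}{2m+n}\Delta^2\right\rfloor+\Delta+1$.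
   Context: All graphs are finite. An $(m,n)$-graph $G$ has a simple underlying undirected graph $und(G)$, in which each adjacency is either an arc (directed) of one of $m$ types, labeled $1,\dots,m$, or an (undirected) edge of one of $n$ types, labeled $m+1,\dots,m+n$. The label function is $\sigma$: for an arc $uv$ (from $u$ to $v$) of label $k$, $\sigma(uv)=k$ and $\sigma(vu)=-k$; for an edge $uv$ of label $k$, $\sigma(uv)=\sigma(vu)=k$. A homomorphism $f:G\to H$ of $(m,n)$-graphs is a map $f:V(G)\to V(H)$ such that for each arc/edge $uv$ of $G$, $f(u)f(v)$ is an arc/edge of $H$ with $\sigma(f(u)f(v))=\sigma(uv)$. The $(m,n)$-chromatic number $\chi_{m,n}(G)$ is the minimum of $|V(H)|$ over all $(m,n)$-graphs $H$ admitting a homomorphism $G\to H$. An $(m,n)$-relative clique of $G$ is a set $R\subseteq V(G)$ such that $f(u)\ne f(v)$ for all distinct $u,v\in R$ and every homomorphism $f$ of $G$ to any $(m,n)$-graph; $\omega_{r(m,n)}(G)$ is the maximum cardinality of an $(m,n)$-relative clique of $G$. An $(m,n)$-absolute clique is an $(m,n)$-graph $A$ with $\chi_{m,n}(A)=|V(A)|$; $\omega_{a(m,n)}(G)$ is the maximum of $|V(A)|$ over subgraphs $A$ of $G$ that are $(m,n)$-absolute cliques. For a family $\mathcal{F}$ of simple graphs and $p\in\{\omega_{r(m,n)},\omega_{a(m,n)}\}$, $p(\mathcal{F})=\max\{p(G): und(G)\in\mathcal{F}\}$. -}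

module Defs where

open import Data.Bool using (Bool; true; false)
open import Data.Fin using (Fin)
open import Data.Fin.Subset using (Subset; _∈_; ∣_∣)
open import Data.Maybe using (Maybe; just; nothing; map; is-just)
open import Data.Nat using (ℕ; zero; suc; _≤_; _⊔_)
open import Data.Product using (Σ; ∃; _×_; _,_)
open import Data.Vec using (tabulate)
open import Data.Vec.Functional using (foldr)
open import Function.Definitions using (Injective)
open import Relation.Binary.PropositionalEquality using (_≡_; _≢_; refl; cong; trans)

IsMax : (ℕ → Set) → ℕ → Set
IsMax P k = P k × (∀ j → P j → j ≤ k)

IsMin : (ℕ → Set) → ℕ → Set
IsMin P k = P k × (∀ j → P j → k ≤ j)

record Graph (N : ℕ) : Set where
  field
    adj     : Fin N → Fin N → Bool
    symm    : ∀ u v → adj v u ≡ adj u v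
    irrefl  : ∀ u → adj u u ≡ false

  neighbours : Fin N → Subset N
  neighbours v = tabulate (adj v)

  degree : Fin N → ℕ
  degree v = ∣ neighbours v ∣

  maxDegree : ℕ
  maxDegree = foldr _⊔_ 0 degree

  data Walk : Fin N → Fin N → ℕ → Set where
    stop : ∀ {u} → Walk u u zero
    step : ∀ {u v w k} → adj u v ≡ true → Walk v w k → Walk u w (suc k)

  IsDistance : Fin N → Fin N → ℕ → Set
  IsDistance u v = IsMin (Walk u v)

  -- A disconnected graph has infinite diameter: every distance must exist.
  DiameterAtMost : ℕ → Set
  DiameterAtMost d = ∀ u v → ∃ λ k → IsDistance u v k × k ≤ d

open Graph public using (maxDegree; DiameterAtMost)

Family : Set₁
Family = ∀ {N} → Graph N → Set

𝒢 : ℕ → Family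
𝒢 Δ G = maxDegree G ≤ Δ

-- Isν d Δ k : the maximum order ν(d, Δ) of a graph of diameter at most d and
-- maximum degree at most Δ is k.
Isν : ℕ → ℕ → ℕ → Set
Isν d Δ = IsMax λ k → Σ (Graph k) λ G → DiameterAtMost G d × maxDegree G ≤ Δ

-- The values of σ: with arc and edge types indexed from 0, arc⁺ i stands for
-- i+1, arc⁻ i for -(i+1), and edge j for m+j+1.
data Label (m n : ℕ) : Set where
  arc⁺ arc⁻ : Fin m → Label m n
  edge      : Fin n → Label m n

-- σ(vu) as a function of σ(uv).
reverse : ∀ {m n} → Label m n → Label m n
reverse (arc⁺ i) = arc⁻ i
reverse (arc⁻ i) = arc⁺ i
reverse (edge j) = edge j

-- (m,n)-graphs with vertex set Fin N.  σ u v is nothing when u and v are not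
-- adjacent, just (arc⁺ i) when there is an arc of type i from u to v, and
-- just (arc⁻ i) when there is an arc of type i from v to u.
record MNGraph (m n N : ℕ) : Set where
  field
    σ        : Fin N → Fin N → Maybe (Label m n)
    σ-rev    : ∀ u v → σ v u ≡ map reverse (σ u v)
    σ-irrefl : ∀ u → σ u u ≡ nothing

open MNGraph public

is-just-map : ∀ {A B : Set} (f : A → B) (x : Maybe A) → is-just (map f x) ≡ is-just x
is-just-map f (just _) = refl
is-just-map f nothing  = refl

und : ∀ {m n N} → MNGraph m n N → Graph N
und G = record
  { adj    = λ u v → is-just (σ G u v)
  ; symm   = λ u v → trans (cong is-just (σ-rev G u v)) (is-just-map reverse (σ G u v))
  ; irrefl = λ u → cong is-just (σ-irrefl G u)
  }

IsHom : ∀ {m n N M} → MNGraph m n N → MNGraph m n M → (Fin N → Fin M) → Set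
IsHom G H f = ∀ u v l → σ G u v ≡ just l → σ H (f u) (f v) ≡ just l

-- Isχ G k : the (m,n)-chromatic number of G is k.
Isχ : ∀ {m n N} → MNGraph m n N → ℕ → Set
Isχ {m} {n} G = IsMin λ k → Σ (MNGraph m n k) λ H → ∃ λ f → IsHom G H f

IsRelativeClique : ∀ {m n N} → MNGraph m n N → Subset N → Set
IsRelativeClique {m} {n} {N} G R =
  ∀ {M} (H : MNGraph m n M) (f : Fin N → Fin M) → IsHom G H f →
  ∀ u v → u ∈ R → v ∈ R → u ≢ v → f u ≢ f v

IsAbsoluteClique : ∀ {m n N} → MNGraph m n N → Set
IsAbsoluteClique {N = N} A = Isχ A N

-- Subgraphs are not necessarily induced; as every vertex set is some Fin k,
-- a subgraph is presented by an injective label-preserving map into G.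
IsSubgraph : ∀ {m n k N} → MNGraph m n k → MNGraph m n N → Set
IsSubgraph A G = ∃ λ ι → Injective _≡_ _≡_ ι × IsHom A G ι

-- A parameter p of (m,n)-graphs is given by its graph: p G k means p(G) = k.
Parameter : ℕ → ℕ → Set₁
Parameter m n = ∀ {N} → MNGraph m n N → ℕ → Set

ωᵣ : ∀ m n → Parameter m n
ωᵣ m n {N} G = IsMax λ k → Σ (Subset N) λ R → IsRelativeClique G R × ∣ R ∣ ≡ k

ωₐ : ∀ m n → Parameter m n
ωₐ m n G = IsMax λ k → Σ (MNGraph m n k) λ A → IsSubgraph A G × IsAbsoluteClique A

-- OnFamily p ℱ k : max { p(G) : und(G) ∈ ℱ } = k.
OnFamily : ∀ {m n} → Parameter m n → Family → ℕ → Set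
OnFamily {m} {n} p ℱ =
  IsMax λ k → ∃ λ N → Σ (MNGraph m n N) λ G → ℱ (und G) × p G k

{-# OPTIONS --safe #-}

-- Write p = 2m+n. No homomorphism identifies two vertices iff they are adjacent or joined by a special
-- 2-path, i.e. have a common neighbour that sees them with different labels; otherwise the two can be
-- merged. Hence all vertices of a relative clique are pairwise at distance at most 2, which gives the Moore
-- bound Δ²+1. For the sharper bound, count ordered pairs of clique vertices by the centre w of a special
-- 2-path: if w has d neighbours in the clique, Cauchy-Schwarz over the p label classes shows that at most
-- (1-1/p)d² ordered pairs are special through w, and d² sums to at most Δ²|R|.
-- When Δ < p, Vizing's theorem colours the edges of a graph of diameter 2 properly with p colours. The union
-- of two colour classes is bipartite, so 2m of the classes can be paired and each pair oriented as one arc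
-- type such that all labels at a vertex are distinct; the result is an absolute clique.
-- The maxima exist constructively since both clique notions are decidable and a relative clique R is
-- still one in the subgraph induced by R and its neighbours, whose order is at most |R|(1+Δ).
module Submission where

open import Defs
open import Data.Bool using (Bool; true; false; not; if_then_else_)
import Data.Bool.Properties as Bool
open import Data.Fin using (Fin; zero; suc; _≟_; toℕ; splitAt; _↑ˡ_; _↑ʳ_; punchOut)
open import Data.Fin.Permutation.Components using (transpose; transpose-inverse)
open import Data.Fin.Properties using (any?; all?; suc-injective; toℕ-injective; splitAt-↑ˡ; splitAt-↑ʳ; join-splitAt; punchOut-injective; punchOut-cong; injective⇒≤)
open import Data.Fin.Subset using (Subset; ∣_∣; _∈_; _∉_; _∪_; ⁅_⁆; ⊤)
open import Data.Fin.Subset.Properties using (_∈?_; x∈⁅x⁆; x∈⁅y⁆⇒x≡y; p⊆p∪q; q⊆p∪q; x∈p∪q⁻; p⊂q⇒∣p∣<∣q∣; ∣p∣≤n; ∣p∣≡n⇒p≡⊤; ∈⊤; ∣⊤∣≡n)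
open import Data.List using (List; []; _∷_; allFin; cartesianProduct)
import Data.List.Membership.DecPropositional as DecMembership
open import Data.List.Membership.Propositional using () renaming (_∈_ to _∈ᴸ_)
open import Data.List.Membership.Propositional.Properties using (∈-allFin; ∈-cartesianProduct⁺)
open import Data.List.Relation.Unary.Any using (here; there)
open import Data.Maybe as Maybe using (Maybe; just; nothing; is-just)
open import Data.Maybe.Properties using (≡-dec; just-injective)
open import Data.Nat using (ℕ; zero; suc; _+_; _*_; _∸_; _^_; _≤_; _<_; _>_; _/_; _⊔_; z≤n; s≤s; NonZero)
open import Data.Nat.DivMod using (m*n/n≡m; /-monoˡ-≤)
open import Data.Nat.Properties hiding (suc-injective) renaming (_≟_ to _≟ᴺ_)
open import Algebra.Properties.Semiring.Sum +-*-semiring using (sum; sum-cong-≗; ∑-distrib-+; ∑-comm; *-distribˡ-sum; *-distribʳ-sum)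
open import Data.Nat.Tactic.RingSolver using (solve-∀)
open import Data.Product using (Σ; ∃; _×_; _,_; proj₁; proj₂)
open import Data.Sum using (_⊎_; inj₁; inj₂; [_,_]′)
open import Data.Vec using (Vec; []; _∷_; lookup; tabulate)
import Data.Vec.Functional as Vector
open import Data.Vec.Properties using (lookup∘tabulate; lookup⇒[]=; []=⇒lookup)
open import Function using (_∘_; id; case_of_)
open import Function.Definitions using (Injective)
open import Relation.Binary using (DecidableEquality; tri<; tri≈; tri>)
open import Relation.Binary.PropositionalEquality using (_≡_; _≢_; refl; sym; trans; cong; cong₂; subst; subst₂)
open import Relation.Nullary using (Dec; ¬_; yes; no; does; contradiction; ¬?; _×-dec_; _⊎-dec_; _→-dec_)
open import Relation.Nullary.Decidable using (dec-true; dec-false; map′; decidable-stable)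

-- Finite sums

⟦_⟧ : Bool → ℕ
⟦ false ⟧ = 0
⟦ true  ⟧ = 1

𝟙 : {P : Set} → Dec P → ℕ
𝟙 P? = ⟦ does P? ⟧

sum-mono : ∀ {n} {f g : Fin n → ℕ} → (∀ i → f i ≤ g i) → sum f ≤ sum g
sum-mono {zero}  f≤g = z≤n
sum-mono {suc n} f≤g = +-mono-≤ (f≤g zero) (sum-mono (f≤g ∘ suc))

sum-const : ∀ n c → sum {n} (λ _ → c) ≡ n * c
sum-const zero    c = refl
sum-const (suc n) c = cong (c +_) (sum-const n c)

sum-zero : ∀ {n} {f : Fin n → ℕ} → (∀ i → f i ≡ 0) → sum f ≡ 0
sum-zero {n} f≡0 = trans (sum-cong-≗ f≡0) (trans (sum-const n 0) (*-zeroʳ n))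

term≤sum : ∀ {n} (f : Fin n → ℕ) i → f i ≤ sum f
term≤sum f zero    = m≤m+n _ _
term≤sum f (suc i) = ≤-trans (term≤sum (f ∘ suc) i) (m≤n+m _ _)

𝟙-yes : {P : Set} (P? : Dec P) → P → 𝟙 P? ≡ 1
𝟙-yes (yes _) p = refl
𝟙-yes (no ¬p) p = contradiction p ¬p

𝟙-no : {P : Set} (P? : Dec P) → ¬ P → 𝟙 P? ≡ 0
𝟙-no (yes p) ¬p = contradiction p ¬p
𝟙-no (no _)  ¬p = refl

sum-𝟙-unique : ∀ {n} {P : Fin n → Set} (P? : ∀ i → Dec (P i)) →
               (∀ i j → P i → P j → i ≡ j) → sum (λ i → 𝟙 (P? i)) ≤ 1
sum-𝟙-unique {zero}  P? uniq = z≤n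
sum-𝟙-unique {suc n} P? uniq with P? zero
... | no _   = sum-𝟙-unique (P? ∘ suc) (λ i j p q → suc-injective (uniq _ _ p q))
... | yes p₀ = ≤-reflexive (cong suc (sum-zero λ i →
                 𝟙-no (P? (suc i)) λ pᵢ → contradiction (uniq zero (suc i) p₀ pᵢ) λ ()))

sum-select : ∀ {n} (i : Fin n) (f : Fin n → ℕ) → sum (λ x → 𝟙 (i ≟ x) * f x) ≡ f i
sum-select {suc n} zero f =
  trans (cong₂ _+_ (+-identityʳ (f zero)) (sum-zero {n} {λ _ → 0} λ _ → refl)) (+-identityʳ _)
sum-select (suc i) f = sum-select i (f ∘ suc)

sum-𝟙-just : ∀ {n} (x : Maybe (Fin n)) → sum (λ a → 𝟙 (≡-dec _≟_ x (just a))) ≡ ⟦ is-just x ⟧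
sum-𝟙-just {n} nothing  = sum-zero {n} {λ _ → 0} (λ _ → refl)
sum-𝟙-just {n} (just c) =
  trans (sum-cong-≗ {n} (λ a → sym (trans (*-identityʳ _) (same a)))) (sum-select c (λ _ → 1))
  where
  same : ∀ a → 𝟙 (c ≟ a) ≡ 𝟙 (≡-dec _≟_ (just c) (just a))
  same a with c ≟ a
  ... | yes _ = refl
  ... | no  _ = refl

-- Each `f (ι i)` is a sum over all `x`, weighted by whether `ι i` equals `x`. After exchanging the
-- sums, injectivity bounds the weight of each `x` by 1.
sum-injective-≤ : ∀ {m n} {ι : Fin m → Fin n} → Injective _≡_ _≡_ ι →
                  (f : Fin n → ℕ) → sum (f ∘ ι) ≤ sum f
sum-injective-≤ {ι = ι} inj f = begin
  sum (f ∘ ι)                                    ≡⟨ sum-cong-≗ (λ i → sum-select (ι i) f) ⟨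
  sum (λ i → sum (λ x → 𝟙 (ι i ≟ x) * f x))      ≡⟨ ∑-comm (λ i x → 𝟙 (ι i ≟ x) * f x) ⟩
  sum (λ x → sum (λ i → 𝟙 (ι i ≟ x) * f x))      ≡⟨ sum-cong-≗ (λ x → *-distribʳ-sum (f x) (λ i → 𝟙 (ι i ≟ x))) ⟨
  sum (λ x → sum (λ i → 𝟙 (ι i ≟ x)) * f x)      ≤⟨ sum-mono (λ x → *-monoˡ-≤ (f x)
                                                     (sum-𝟙-unique (λ i → ι i ≟ x) λ i j p q → inj (trans p (sym q)))) ⟩
  sum (λ x → 1 * f x)                            ≡⟨ sum-cong-≗ (λ x → *-identityˡ (f x)) ⟩
  sum f                                          ∎
  where open ≤-Reasoning

2ab≤a²+b² : ∀ a b → 2 * (a * b) ≤ a * a + b * b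
2ab≤a²+b² a b with ≤-total a b
... | inj₁ a≤b with (d , refl) ← m≤n⇒∃[o]m+o≡n a≤b =
  ≤-trans (m≤m+n _ (d * d)) (≤-reflexive (eq a d))
  where
  eq : ∀ a d → 2 * (a * (a + d)) + d * d ≡ a * a + (a + d) * (a + d)
  eq = solve-∀
... | inj₂ b≤a with (d , refl) ← m≤n⇒∃[o]m+o≡n b≤a =
  ≤-trans (m≤m+n _ (d * d)) (≤-reflexive (eq b d))
  where
  eq : ∀ b d → 2 * ((b + d) * b) + d * d ≡ (b + d) * (b + d) + b * b
  eq = solve-∀

-- Induction on `n`: the cross term of the expanded square is bounded summand by summand by 2ab ≤ a²
-- + b².
cauchy-schwarz : ∀ {n} (f : Fin n → ℕ) → sum f * sum f ≤ n * sum (λ i → f i * f i)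
cauchy-schwarz {zero}  f = z≤n
cauchy-schwarz {suc n} f = begin
  (x + S) * (x + S)                ≡⟨ square x S ⟩
  x * x + 2 * (x * S) + S * S      ≤⟨ +-mono-≤ (+-monoʳ-≤ (x * x) cross) (cauchy-schwarz (f ∘ suc)) ⟩
  x * x + (n * (x * x) + Q) + n * Q ≡⟨ regroup n (x * x) Q ⟩
  suc n * (x * x + Q)              ∎
  where
  open ≤-Reasoning
  x S Q : ℕ
  x = f zero
  S = sum (f ∘ suc)
  Q = sum (λ i → f (suc i) * f (suc i))
  square : ∀ x S → (x + S) * (x + S) ≡ x * x + 2 * (x * S) + S * S
  square = solve-∀
  regroup : ∀ n y Q → y + (n * y + Q) + n * Q ≡ suc n * (y + Q)
  regroup = solve-∀
  cross : 2 * (x * S) ≤ n * (x * x) + Q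
  cross = begin
    2 * (x * S)                                       ≡⟨ cong (2 *_) (*-distribˡ-sum x (f ∘ suc)) ⟩
    2 * sum (λ i → x * f (suc i))                     ≡⟨ *-distribˡ-sum 2 (λ i → x * f (suc i)) ⟩
    sum (λ i → 2 * (x * f (suc i)))                   ≤⟨ sum-mono (λ i → 2ab≤a²+b² x (f (suc i))) ⟩
    sum (λ i → x * x + f (suc i) * f (suc i))         ≡⟨ ∑-distrib-+ (λ _ → x * x) (λ i → f (suc i) * f (suc i)) ⟩
    sum {n} (λ _ → x * x) + Q                         ≡⟨ cong (_+ Q) (sum-const n (x * x)) ⟩
    n * (x * x) + Q                                   ∎

∣S∣≡sum : ∀ {N} (S : Subset N) → ∣ S ∣ ≡ sum (λ i → ⟦ lookup S i ⟧)
∣S∣≡sum []          = refl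
∣S∣≡sum (true  ∷ S) = cong suc (∣S∣≡sum S)
∣S∣≡sum (false ∷ S) = ∣S∣≡sum S

∣tabulate∣≡sum : ∀ {N} (f : Fin N → Bool) → ∣ tabulate f ∣ ≡ sum (⟦_⟧ ∘ f)
∣tabulate∣≡sum f = trans (∣S∣≡sum (tabulate f)) (sum-cong-≗ λ i → cong ⟦_⟧ (lookup∘tabulate f i))

max≤⇒≤ : ∀ {N D} (f : Fin N → ℕ) → Vector.foldr _⊔_ 0 f ≤ D → ∀ i → f i ≤ D
max≤⇒≤ f max≤ zero    = ≤-trans (m≤m⊔n _ _) max≤
max≤⇒≤ f max≤ (suc i) = max≤⇒≤ (f ∘ suc) (≤-trans (m≤n⊔m (f zero) _) max≤) i

≤⇒max≤ : ∀ {N D} (f : Fin N → ℕ) → (∀ i → f i ≤ D) → Vector.foldr _⊔_ 0 f ≤ D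
≤⇒max≤ {zero}  f f≤ = z≤n
≤⇒max≤ {suc N} f f≤ = ⊔-lub (f≤ zero) (≤⇒max≤ (f ∘ suc) (f≤ ∘ suc))

deg : ∀ {N} → (Fin N → Fin N → Bool) → Fin N → ℕ
deg adj v = sum (λ u → ⟦ adj v u ⟧)

DegreesAtMost : ∀ {N} → ℕ → (Fin N → Fin N → Bool) → Set
DegreesAtMost Δ adj = ∀ v → deg adj v ≤ Δ

maxDegree⇒degrees : ∀ {N Δ} (G : Graph N) → maxDegree G ≤ Δ → DegreesAtMost Δ (Graph.adj G)
maxDegree⇒degrees G max≤ v =
  subst (_≤ _) (∣tabulate∣≡sum (Graph.adj G v)) (max≤⇒≤ (Graph.degree G) max≤ v)

degrees⇒maxDegree : ∀ {N Δ} (G : Graph N) → DegreesAtMost Δ (Graph.adj G) → maxDegree G ≤ Δ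
degrees⇒maxDegree G deg≤ =
  ≤⇒max≤ (Graph.degree G) λ v → subst (_≤ _) (sym (∣tabulate∣≡sum (Graph.adj G v))) (deg≤ v)

sum-mono-< : ∀ {n} {f g : Fin n → ℕ} → (∀ i → f i ≤ g i) → ∀ i → f i < g i → sum f < sum g
sum-mono-< f≤g zero    f<g = +-mono-<-≤ f<g (sum-mono (f≤g ∘ suc))
sum-mono-< f≤g (suc i) f<g = +-mono-≤-< (f≤g zero) (sum-mono-< (f≤g ∘ suc) i f<g)

∑-rotate : ∀ {l m n} (f : Fin l → Fin m → Fin n → ℕ) →
           sum (λ u → sum (λ v → sum (λ w → f u v w))) ≡ sum (λ w → sum (λ u → sum (λ v → f u v w)))
∑-rotate f = trans (sum-cong-≗ λ u → ∑-comm (f u)) (∑-comm λ u w → sum (λ v → f u v w))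

∑∑-product : ∀ {m n} (f : Fin m → ℕ) (g : Fin n → ℕ) →
             sum (λ u → sum (λ v → f u * g v)) ≡ sum f * sum g
∑∑-product f g =
  trans (sum-cong-≗ λ u → sym (*-distribˡ-sum (f u) g)) (sym (*-distribʳ-sum (sum g) f))

∑∑-mono : ∀ {m n} {f g : Fin m → Fin n → ℕ} → (∀ u v → f u v ≤ g u v) →
          sum (λ u → sum (f u)) ≤ sum (λ u → sum (g u))
∑∑-mono f≤g = sum-mono λ u → sum-mono (f≤g u)

∑∑-distrib-+ : ∀ {m n} (f g : Fin m → Fin n → ℕ) →
               sum (λ u → sum (λ v → f u v + g u v)) ≡ sum (λ u → sum (f u)) + sum (λ u → sum (g u))
∑∑-distrib-+ f g =
  trans (sum-cong-≗ λ u → ∑-distrib-+ (f u) (g u)) (∑-distrib-+ (λ u → sum (f u)) (λ u → sum (g u)))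

⟦⟧≤1 : ∀ b → ⟦ b ⟧ ≤ 1
⟦⟧≤1 false = z≤n
⟦⟧≤1 true  = s≤s z≤n

⟦⟧*≤ : ∀ b n → ⟦ b ⟧ * n ≤ n
⟦⟧*≤ b n = subst (⟦ b ⟧ * n ≤_) (*-identityˡ n) (*-monoˡ-≤ n (⟦⟧≤1 b))

-- The Moore bound and the sharper bound from counting labels

Near : ∀ {N} → (Fin N → Fin N → Bool) → Fin N → Fin N → Set
Near adj u v = adj u v ≡ true ⊎ ∃ λ w → adj u w ≡ true × adj w v ≡ true

module _ {N : ℕ} (adj : Fin N → Fin N → Bool) (symm : ∀ u v → adj v u ≡ adj u v)
         {Δ : ℕ} (deg≤Δ : DegreesAtMost Δ adj) (r : Fin N → Bool) where

  -- Each neighbour `w` of `v` accounts for itself and for its neighbours other than `v`, together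
  -- `deg adj w` vertices. Leaving `v` out of `second` is what saves Δ against the naive 1 + Δ + Δ².
  ball-bound : ∀ v → (∀ u → r u ≡ true → v ≢ u → Near adj v u) → sum (⟦_⟧ ∘ r) ≤ Δ * Δ + 1
  ball-bound v near = begin
    sum (⟦_⟧ ∘ r)
      ≤⟨ sum-mono covered ⟩
    sum (λ u → 𝟙 (v ≟ u) + (⟦ adj v u ⟧ + sum (λ w → ⟦ adj v w ⟧ * second w u)))
      ≡⟨ ∑-distrib-+ (λ u → 𝟙 (v ≟ u)) (λ u → ⟦ adj v u ⟧ + sum (λ w → ⟦ adj v w ⟧ * second w u)) ⟩
    sum (λ u → 𝟙 (v ≟ u)) + sum (λ u → ⟦ adj v u ⟧ + sum (λ w → ⟦ adj v w ⟧ * second w u))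
      ≤⟨ +-mono-≤ (sum-𝟙-unique (v ≟_) λ i j p q → trans (sym p) q)
                  (≤-reflexive (∑-distrib-+ (λ u → ⟦ adj v u ⟧) (λ u → sum (λ w → ⟦ adj v w ⟧ * second w u)))) ⟩
    1 + (sum (λ w → ⟦ adj v w ⟧) + sum (λ u → sum (λ w → ⟦ adj v w ⟧ * second w u)))
      ≡⟨ cong (λ x → 1 + (sum (λ w → ⟦ adj v w ⟧) + x))
           (trans (∑-comm (λ u w → ⟦ adj v w ⟧ * second w u))
                  (sum-cong-≗ λ w → sym (*-distribˡ-sum ⟦ adj v w ⟧ (second w)))) ⟩
    1 + (sum (λ w → ⟦ adj v w ⟧) + sum (λ w → ⟦ adj v w ⟧ * sum (second w)))
      ≡⟨ cong suc (sym (∑-distrib-+ (λ w → ⟦ adj v w ⟧) (λ w → ⟦ adj v w ⟧ * sum (second w)))) ⟩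
    1 + sum (λ w → ⟦ adj v w ⟧ + ⟦ adj v w ⟧ * sum (second w))
      ≤⟨ s≤s (sum-mono through) ⟩
    1 + sum (λ w → ⟦ adj v w ⟧ * Δ)
      ≡⟨ cong suc (sym (*-distribʳ-sum Δ (λ w → ⟦ adj v w ⟧))) ⟩
    1 + deg adj v * Δ
      ≤⟨ s≤s (*-monoˡ-≤ Δ (deg≤Δ v)) ⟩
    1 + Δ * Δ
      ≡⟨ +-comm 1 (Δ * Δ) ⟩
    Δ * Δ + 1 ∎
    where
    open ≤-Reasoning

    second : Fin N → Fin N → ℕ
    second w u = ⟦ not (does (v ≟ u)) ⟧ * ⟦ adj w u ⟧

    covered : ∀ u → ⟦ r u ⟧ ≤ 𝟙 (v ≟ u) + (⟦ adj v u ⟧ + sum (λ w → ⟦ adj v w ⟧ * second w u))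
    covered u with r u in ru | v ≟ u
    ... | false | _       = z≤n
    ... | true  | yes _   = s≤s z≤n
    ... | true  | no v≢u with near u ru v≢u
    ...   | inj₁ vu rewrite vu = s≤s z≤n
    ...   | inj₂ (w , vw , wu) = ≤-trans (≤-trans (≤-reflexive eq)
              (term≤sum (λ w → ⟦ adj v w ⟧ * (1 * ⟦ adj w u ⟧)) w)) (m≤n+m _ _)
      where
      eq : 1 ≡ ⟦ adj v w ⟧ * (1 * ⟦ adj w u ⟧)
      eq rewrite vw | wu = refl

    split : ∀ w → deg adj w ≡ ⟦ adj w v ⟧ + sum (second w)
    split w = trans (sum-cong-≗ λ u → cases (does (v ≟ u)) ⟦ adj w u ⟧)
                (trans (∑-distrib-+ (λ u → 𝟙 (v ≟ u) * ⟦ adj w u ⟧) (second w))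
                       (cong (_+ sum (second w)) (sum-select v (λ u → ⟦ adj w u ⟧))))
      where
      cases : ∀ b x → x ≡ ⟦ b ⟧ * x + ⟦ not b ⟧ * x
      cases true  x = sym (trans (+-identityʳ _) (*-identityˡ x))
      cases false x = sym (*-identityˡ x)

    through : ∀ w → ⟦ adj v w ⟧ + ⟦ adj v w ⟧ * sum (second w) ≤ ⟦ adj v w ⟧ * Δ
    through w with adj v w in vw
    ... | false = z≤n
    ... | true  = subst₂ _≤_ (trans (split w) (cong₂ _+_ (cong ⟦_⟧ (trans (symm v w) vw)) (sym (*-identityˡ _))))
                    (sym (*-identityˡ Δ)) (deg≤Δ w)

  -- Any member of `r` can serve as the centre of the ball.
  moore-bound : (∀ u v → r u ≡ true → r v ≡ true → u ≢ v → Near adj u v) →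
                sum (⟦_⟧ ∘ r) ≤ Δ * Δ + 1
  moore-bound near with any? (λ v → r v Bool.≟ true)
  ... | yes (v , rv) = ball-bound v (λ u ru → near v u rv ru)
  ... | no none      = ≤-trans (≤-reflexive (sum-zero λ v → cong ⟦_⟧ (Bool.¬-not (λ rv → none (v , rv))))) z≤n

-- Both labels of the 2-path are read from its centre `w`. Because of arcs, `t u w` and `t w u` may
-- differ; only the support of `t` is assumed symmetric below.
Separated : ∀ {N p} → (Fin N → Fin N → Maybe (Fin p)) → Fin N → Fin N → Set
Separated t u v =
  is-just (t u v) ≡ true ⊎ ∃ λ w → ∃ λ a → ∃ λ b → t w u ≡ just a × t w v ≡ just b × a ≢ b

module LabelCount {N q : ℕ} (t : Fin N → Fin N → Maybe (Fin (suc q)))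
         (symm : ∀ u v → is-just (t v u) ≡ is-just (t u v))
         {Δ : ℕ} (deg≤Δ : DegreesAtMost Δ (λ u v → is-just (t u v))) (r : Fin N → Bool) where

  private
    p k : ℕ
    p = suc q
    k = sum (⟦_⟧ ∘ r)

    adj : Fin N → Fin N → Bool
    adj u v = is-just (t u v)

    x : Fin N → Fin N → Fin p → ℕ
    x w u a = 𝟙 (≡-dec _≟_ (t w u) (just a))

    f : Fin N → Fin p → Fin N → ℕ
    f w a u = ⟦ r u ⟧ * x w u a

    y : Fin N → Fin N → ℕ
    y w u = ⟦ r u ⟧ * ⟦ adj w u ⟧

    -- The size, within `r`, of the label class `a` at the centre `w`; these classes partition the
    -- `d w` neighbours of `w` in `r`.
    e : Fin N → Fin p → ℕ
    e w a = sum (f w a)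

    d : Fin N → ℕ
    d w = sum (y w)

    sum-x : ∀ w u → sum (x w u) ≡ ⟦ adj w u ⟧
    sum-x w u = sum-𝟙-just (t w u)

    sum-e : ∀ w → sum (e w) ≡ d w
    sum-e w = trans (∑-comm (f w)) (sum-cong-≗ λ u →
      trans (sym (*-distribˡ-sum ⟦ r u ⟧ (x w u))) (cong (⟦ r u ⟧ *_) (sum-x w u)))

    d≤Δ : ∀ w → d w ≤ Δ
    d≤Δ w = ≤-trans (sum-mono λ u → ⟦⟧*≤ (r u) _) (deg≤Δ w)

    row : ∀ u → sum (λ v → ⟦ r u ⟧ * ⟦ adj u v ⟧) ≤ ⟦ r u ⟧ * Δ
    row u = ≤-trans (≤-reflexive (sym (*-distribˡ-sum ⟦ r u ⟧ (λ v → ⟦ adj u v ⟧)))) (*-monoʳ-≤ ⟦ r u ⟧ (deg≤Δ u))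

    rows : sum (λ u → sum (λ v → ⟦ r u ⟧ * ⟦ adj u v ⟧)) ≤ k * Δ
    rows = ≤-trans (sum-mono row) (≤-reflexive (sym (*-distribʳ-sum Δ (⟦_⟧ ∘ r))))

    sum-d : sum d ≤ k * Δ
    sum-d = ≤-trans (≤-reflexive (trans (∑-comm y)
              (sum-cong-≗ λ u → sum-cong-≗ λ w → cong (λ b → ⟦ r u ⟧ * ⟦ b ⟧) (symm u w)))) rows

    -- One factor `d w` is at most Δ; the sum of the other counts edge ends at members of `r`, at
    -- most Δ for each member.
    sum-d² : sum (λ w → d w * d w) ≤ k * Δ * Δ
    sum-d² = ≤-trans (sum-mono λ w → *-monoʳ-≤ (d w) (d≤Δ w))
               (≤-trans (≤-reflexive (sym (*-distribʳ-sum Δ d))) (*-monoˡ-≤ Δ sum-d))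

    diagonal : sum (λ u → sum (λ v → ⟦ r u ⟧ * 𝟙 (u ≟ v))) ≡ k
    diagonal = sum-cong-≗ λ u →
      trans (sum-cong-≗ λ v → *-comm ⟦ r u ⟧ (𝟙 (u ≟ v))) (sum-select u (λ _ → ⟦ r u ⟧))

    -- A centre sees two vertices with a common label only if it is adjacent to both. At the centre
    -- of a special 2-path the inequality is strict, which `pointwise` exploits.
    sum-ff : ∀ w u v → sum (λ a → f w a u * f w a v) ≤ y w u * y w v
    sum-ff w u v = begin
      sum (λ a → f w a u * f w a v)   ≤⟨ sum-mono (λ a → *-monoʳ-≤ (f w a u) (*-monoʳ-≤ ⟦ r v ⟧ (x≤adj a))) ⟩
      sum (λ a → f w a u * y w v)     ≡⟨ *-distribʳ-sum (y w v) (λ a → f w a u) ⟨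
      sum (λ a → f w a u) * y w v     ≡⟨ cong (_* y w v) (*-distribˡ-sum ⟦ r u ⟧ (x w u)) ⟨
      ⟦ r u ⟧ * sum (x w u) * y w v   ≡⟨ cong (λ z → ⟦ r u ⟧ * z * y w v) (sum-x w u) ⟩
      y w u * y w v                   ∎
      where
      open ≤-Reasoning
      x≤adj : ∀ a → x w v a ≤ ⟦ adj w v ⟧
      x≤adj a = ≤-trans (term≤sum (x w v) a) (≤-reflexive (sum-x w v))

  module _ (separated : ∀ u v → r u ≡ true → r v ≡ true → u ≢ v → Separated t u v) where

    private
      -- The count for a single ordered pair, arranged without subtraction. For members of `r`, the
      -- 1 on the left is paid for by the diagonal term, by adjacency, or by the strict case of
      -- `sum-ff` at the centre of a special 2-path.
      pointwise : ∀ u v →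
        ⟦ r u ⟧ * ⟦ r v ⟧ + sum (λ w → sum (λ a → f w a u * f w a v)) ≤
        ⟦ r u ⟧ * 𝟙 (u ≟ v) + ⟦ r u ⟧ * ⟦ adj u v ⟧ + sum (λ w → y w u * y w v)
      pointwise u v with r u Bool.≟ true | r v Bool.≟ true
      ... | no ¬ru | _      = +-mono-≤ (≤-trans (≤-reflexive (cong (λ b → ⟦ b ⟧ * ⟦ r v ⟧) (Bool.¬-not ¬ru))) z≤n)
                                       (sum-mono λ w → sum-ff w u v)
      ... | yes _  | no ¬rv = +-mono-≤ (≤-trans (≤-reflexive (trans (cong (λ b → ⟦ r u ⟧ * ⟦ b ⟧) (Bool.¬-not ¬rv))
                                                                    (*-zeroʳ ⟦ r u ⟧))) z≤n)
                                       (sum-mono λ w → sum-ff w u v)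
      ... | yes ru | yes rv = inside (u ≟ v)
        where
        1≡rr : ⟦ r u ⟧ * ⟦ r v ⟧ ≡ 1
        1≡rr = cong₂ (λ b c → ⟦ b ⟧ * ⟦ c ⟧) ru rv

        y≡1 : ∀ {w z a} → r z ≡ true → t w z ≡ just a → y w z ≡ 1
        y≡1 rz wz = cong₂ (λ b c → ⟦ b ⟧ * ⟦ is-just c ⟧) rz wz

        inside : Dec (u ≡ v) →
          ⟦ r u ⟧ * ⟦ r v ⟧ + sum (λ w → sum (λ a → f w a u * f w a v)) ≤
          ⟦ r u ⟧ * 𝟙 (u ≟ v) + ⟦ r u ⟧ * ⟦ adj u v ⟧ + sum (λ w → y w u * y w v)
        inside (yes u≡v) = +-mono-≤
          (≤-trans (≤-reflexive (trans 1≡rr (sym (cong₂ (λ b c → ⟦ b ⟧ * c) ru (𝟙-yes (u ≟ v) u≡v))))) (m≤m+n _ _))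
          (sum-mono λ w → sum-ff w u v)
        inside (no u≢v) with separated u v ru rv u≢v
        ... | inj₁ uv = +-mono-≤
          (≤-trans (≤-reflexive (trans 1≡rr (sym (cong₂ (λ b c → ⟦ b ⟧ * ⟦ c ⟧) ru uv)))) (m≤n+m _ (⟦ r u ⟧ * 𝟙 (u ≟ v))))
          (sum-mono λ w → sum-ff w u v)
        ... | inj₂ (w , a , b , wu , wv , a≢b) =
          ≤-trans (≤-reflexive (cong (_+ sum (λ w → sum (λ a → f w a u * f w a v))) 1≡rr))
            (≤-trans (sum-mono-< (λ w → sum-ff w u v) w strict) (m≤n+m _ _))
          where
          vanish : ∀ c → f w c u * f w c v ≡ 0
          vanish c with ≡-dec _≟_ (t w u) (just c) | ≡-dec _≟_ (t w v) (just c)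
          ... | no _   | vc     = cong (_* (⟦ r v ⟧ * 𝟙 vc)) (*-zeroʳ ⟦ r u ⟧)
          ... | yes _  | no _   = trans (cong (⟦ r u ⟧ * 1 *_) (*-zeroʳ ⟦ r v ⟧)) (*-zeroʳ (⟦ r u ⟧ * 1))
          ... | yes uc | yes vc = contradiction
            (just-injective (trans (sym wu) (trans uc (trans (sym vc) wv)))) a≢b

          strict : sum (λ c → f w c u * f w c v) < y w u * y w v
          strict = ≤-reflexive (trans (cong suc (sum-zero vanish)) (sym (cong₂ _*_ (y≡1 ru wu) (y≡1 rv wv))))

      E² D² : ℕ
      E² = sum (λ w → sum (λ a → e w a * e w a))
      D² = sum (λ w → d w * d w)

      D²≤pE² : D² ≤ p * E²
      D²≤pE² = ≤-trans (sum-mono λ w → subst (λ z → z * z ≤ p * sum (λ a → e w a * e w a)) (sum-e w) (cauchy-schwarz (e w)))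
        (≤-reflexive (sym (*-distribˡ-sum p (λ w → sum (λ a → e w a * e w a)))))

      -- Summing `pointwise` over all ordered pairs and exchanging sums turns the products at each
      -- centre into the squares of `e w a` and `d w`.
      pairs : k * k + E² ≤ k + k * Δ + D²
      pairs = begin
        k * k + E²
          ≡⟨ cong₂ _+_ (∑∑-product (⟦_⟧ ∘ r) (⟦_⟧ ∘ r))
               (trans (∑-rotate (λ u v w → sum (λ a → f w a u * f w a v)))
                 (sum-cong-≗ λ w → trans (∑-rotate (λ u v a → f w a u * f w a v))
                   (sum-cong-≗ λ a → ∑∑-product (f w a) (f w a)))) ⟨
        _ ≡⟨ ∑∑-distrib-+ (λ u v → ⟦ r u ⟧ * ⟦ r v ⟧) (λ u v → sum (λ w → sum (λ a → f w a u * f w a v))) ⟨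
        _ ≤⟨ ∑∑-mono pointwise ⟩
        _ ≡⟨ ∑∑-distrib-+ (λ u v → ⟦ r u ⟧ * 𝟙 (u ≟ v) + ⟦ r u ⟧ * ⟦ adj u v ⟧) (λ u v → sum (λ w → y w u * y w v)) ⟩
        _ ≡⟨ cong₂ _+_ (∑∑-distrib-+ (λ u v → ⟦ r u ⟧ * 𝟙 (u ≟ v)) (λ u v → ⟦ r u ⟧ * ⟦ adj u v ⟧))
               (trans (∑-rotate (λ u v w → y w u * y w v)) (sum-cong-≗ λ w → ∑∑-product (y w) (y w))) ⟩
        _ ≤⟨ +-monoˡ-≤ D² (+-mono-≤ (≤-reflexive diagonal) rows) ⟩
        k + k * Δ + D² ∎
        where open ≤-Reasoning

      -- Scaling `pairs` by `p` lets `D²≤pE²` replace `E²` without division. Of the resulting `p`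
      -- copies of `D²` one cancels, leaving `q`.
      weighted-pairs : p * (k * k) ≤ p * (k + k * Δ) + q * D²
      weighted-pairs = +-cancelʳ-≤ D² _ _ (begin
        p * (k * k) + D²                ≤⟨ +-monoʳ-≤ (p * (k * k)) D²≤pE² ⟩
        p * (k * k) + p * E²            ≡⟨ *-distribˡ-+ p (k * k) E² ⟨
        p * (k * k + E²)                ≤⟨ *-monoʳ-≤ p pairs ⟩
        p * (k + k * Δ + D²)            ≡⟨ regroup q (k + k * Δ) D² ⟩
        p * (k + k * Δ) + q * D² + D²   ∎)
        where
        open ≤-Reasoning
        regroup : ∀ q x z → suc q * (x + z) ≡ suc q * x + q * z + z
        regroup = solve-∀

    bound : sum (⟦_⟧ ∘ r) ≤ (q * (Δ * Δ)) / suc q + Δ + 1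
    bound with k in k≡
    -- The case of an empty `r` is split off because the other case cancels a factor `k`.
    ... | zero   = z≤n
    ... | suc k′ = begin
      -- Δ + 1 is taken out before dividing, so that only q·Δ² stands under the floor; with
      -- truncated subtraction this also covers small `k₁`.
      k₁                                      ≤⟨ m≤n+m∸n k₁ (Δ + 1) ⟩
      (Δ + 1) + (k₁ ∸ (Δ + 1))                ≡⟨ +-comm (Δ + 1) _ ⟩
      (k₁ ∸ (Δ + 1)) + (Δ + 1)                ≡⟨ cong (_+ (Δ + 1)) (m*n/n≡m (k₁ ∸ (Δ + 1)) p) ⟨
      (k₁ ∸ (Δ + 1)) * p / p + (Δ + 1)        ≤⟨ +-monoˡ-≤ (Δ + 1) (/-monoˡ-≤ p excess) ⟩
      (q * (Δ * Δ)) / p + (Δ + 1)             ≡⟨ +-assoc _ Δ 1 ⟨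
      (q * (Δ * Δ)) / p + Δ + 1               ∎
      where
      open ≤-Reasoning
      k₁ : ℕ
      k₁ = suc k′

      bound′ : (k₁ * p) * k₁ ≤ (q * (Δ * Δ) + (Δ + 1) * p) * k₁
      bound′ = begin
        (k₁ * p) * k₁                              ≡⟨ lhs p k₁ ⟩
        p * (k₁ * k₁)                              ≡⟨ cong (λ z → p * (z * z)) k≡ ⟨
        p * (k * k)                                ≤⟨ weighted-pairs ⟩
        p * (k + k * Δ) + q * D²                   ≤⟨ +-monoʳ-≤ _ (*-monoʳ-≤ q sum-d²) ⟩
        p * (k + k * Δ) + q * (k * Δ * Δ)          ≡⟨ cong (λ z → p * (z + z * Δ) + q * (z * Δ * Δ)) k≡ ⟩
        p * (k₁ + k₁ * Δ) + q * (k₁ * Δ * Δ)       ≡⟨ rhs p q k₁ Δ ⟩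
        (q * (Δ * Δ) + (Δ + 1) * p) * k₁           ∎
        where
        lhs : ∀ p k → (k * p) * k ≡ p * (k * k)
        lhs = solve-∀
        rhs : ∀ p q k Δ → p * (k + k * Δ) + q * (k * Δ * Δ) ≡ (q * (Δ * Δ) + (Δ + 1) * p) * k
        rhs = solve-∀

      excess : (k₁ ∸ (Δ + 1)) * p ≤ q * (Δ * Δ)
      excess = begin
        (k₁ ∸ (Δ + 1)) * p                                ≡⟨ *-distribʳ-∸ p k₁ (Δ + 1) ⟩
        k₁ * p ∸ (Δ + 1) * p                              ≤⟨ ∸-monoˡ-≤ ((Δ + 1) * p) (*-cancelʳ-≤ _ _ k₁ bound′) ⟩
        q * (Δ * Δ) + (Δ + 1) * p ∸ (Δ + 1) * p           ≡⟨ m+n∸n≡m (q * (Δ * Δ)) ((Δ + 1) * p) ⟩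
        q * (Δ * Δ)                                       ∎

label-bound : ∀ {N p} .{{_ : NonZero p}} (t : Fin N → Fin N → Maybe (Fin p)) →
  (∀ u v → is-just (t v u) ≡ is-just (t u v)) → ∀ {Δ} → DegreesAtMost Δ (λ u v → is-just (t u v)) →
  (r : Fin N → Bool) → (∀ u v → r u ≡ true → r v ≡ true → u ≢ v → Separated t u v) →
  sum (⟦_⟧ ∘ r) ≤ ((p ∸ 1) * (Δ * Δ)) / p + Δ + 1
label-bound {p = suc q} = LabelCount.bound

-- Alternating paths of two involutions

insert : ∀ {N} → Fin N → Subset N → Subset N
insert z S = S ∪ ⁅ z ⁆

z∈insert : ∀ {N} {z : Fin N} (S : Subset N) → z ∈ insert z S
z∈insert {z = z} S = q⊆p∪q S ⁅ z ⁆ (x∈⁅x⁆ z)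

∈insert⁺ : ∀ {N} {z s : Fin N} {S} → s ∈ S → s ∈ insert z S
∈insert⁺ {z = z} = p⊆p∪q ⁅ z ⁆

∈insert⁻ : ∀ {N} {z s : Fin N} {S} → s ∈ insert z S → s ≡ z ⊎ s ∈ S
∈insert⁻ {z = z} {S = S} s∈ with x∈p∪q⁻ S ⁅ z ⁆ s∈
... | inj₁ s∈S = inj₂ s∈S
... | inj₂ s∈z = inj₁ (x∈⁅y⁆⇒x≡y z s∈z)

exhausted : ∀ {N} (S : Subset N) → N ≤ ∣ S ∣ → ∀ z → z ∈ S
exhausted S N≤ z = subst (z ∈_) (sym (∣p∣≡n⇒p≡⊤ (≤-antisym (∣p∣≤n S) N≤))) ∈⊤

-- Fuel bounds the number of vertices still outside `S`. This invariant makes both the path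
-- traversal and the growth of a fan terminate.
insert-fuel : ∀ {N fuel} {z : Fin N} {S} → z ∉ S → N ≤ suc fuel + ∣ S ∣ → N ≤ fuel + ∣ insert z S ∣
insert-fuel {fuel = fuel} {z} {S} z∉S N≤ =
  ≤-trans N≤ (≤-trans (≤-reflexive (sym (+-suc fuel ∣ S ∣)))
    (+-monoʳ-≤ fuel (p⊂q⇒∣p∣<∣q∣ (∈insert⁺ , z , z∈insert S , z∉S))))

module Kempe {N : ℕ} (step : Bool → Fin N → Fin N) (step-inv : ∀ b u → step b (step b u) ≡ u) where

  Alternating : (Fin N → Bool) → Set
  Alternating s = ∀ b u → step b u ≢ u → s (step b u) ≡ not (s u)

  -- Regard `u` and `step b u` as joined by an edge of kind `b`, a fixed point having no such edge.
  -- The component of a vertex without a `false` edge is a path that can only start with a `true`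
  -- edge. Another vertex of it without a `false` edge must be the far end, reached by a `true` edge
  -- and so after an odd number of edges: this is `parity`.
  record Component (x : Fin N) : Set where
    field
      S      : Subset N
      x∈S    : x ∈ S
      closed : ∀ b {s} → s ∈ S → step b s ∈ S
      end    : Fin N
      ends   : ∀ b {s} → s ∈ S → step b s ≡ s → s ≡ x ⊎ s ≡ end
      parity : ∀ {s} → Alternating s → ∀ {v} → v ∈ S → v ≢ x → step false v ≡ v → s v ≡ not (s x)

  module _ {x : Fin N} (x-fixed : step false x ≡ x) where

    -- The part S of an alternating path that starts at x and has reached h; its next edge is of kind t.
    record Path (t : Bool) (h : Fin N) (S : Subset N) : Set where
      field
        x∈S    : x ∈ S
        h∈S    : h ∈ S
        back   : step (not t) h ∈ S
        closed : ∀ {s} → s ∈ S → s ≢ h → step t s ∈ S × step t s ≢ h × step (not t) s ∈ S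
        inner  : ∀ {s} → s ∈ S → s ≢ x → s ≢ h → ∀ b → step b s ≢ s
        moved  : h ≢ x → step (not t) h ≢ h
        parity : ∀ {s} → Alternating s → s h ≡ (if t then s x else not (s x))

    both : ∀ (P : Bool → Set) t → P t → P (not t) → ∀ b → P b
    both P false pt pn false = pt
    both P false pt pn true  = pn
    both P true  pt pn false = pn
    both P true  pt pn true  = pt

    unit : Path true x ⁅ x ⁆
    unit = record
      { x∈S    = x∈⁅x⁆ x
      ; h∈S    = x∈⁅x⁆ x
      ; back   = subst (_∈ ⁅ x ⁆) (sym x-fixed) (x∈⁅x⁆ x)
      ; closed = λ s∈ s≢x → contradiction (x∈⁅y⁆⇒x≡y x s∈) s≢x
      ; inner  = λ s∈ s≢x → contradiction (x∈⁅y⁆⇒x≡y x s∈) s≢x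
      ; moved  = λ x≢x → contradiction refl x≢x
      ; parity = λ _ → refl
      }

    module _ {t : Bool} {h : Fin N} {S : Subset N} (P : Path t h S) where
      open Path P

      -- If the next vertex were already in `S`, `closed` would forbid its own `t`-step to be `h`,
      -- against the involution. Hence the path never runs back into itself.
      fresh : step t h ≢ h → step t h ∉ S
      fresh th≢h th∈S = proj₁ (proj₂ (closed th∈S th≢h)) (step-inv t h)

      stays : ∀ {s} → s ∈ S → step (not t) s ∈ S
      stays {s} s∈S with s ≟ h
      ... | yes refl = back
      ... | no s≢h   = proj₂ (proj₂ (closed s∈S s≢h))

      extend : step t h ≢ h → Path (not t) (step t h) (insert (step t h) S)
      extend th≢h = record
        { x∈S    = ∈insert⁺ x∈S
        ; h∈S    = z∈insert S
        ; back   = subst (λ b → step b h′ ∈ insert h′ S) (sym (Bool.not-involutive t))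
                     (subst (_∈ insert h′ S) (sym (step-inv t h)) (∈insert⁺ h∈S))
        ; closed = λ s∈ s≢h′ → closed′ (old s∈ s≢h′)
        ; inner  = λ s∈ s≢x s≢h′ → inner′ (old s∈ s≢h′) s≢x
        ; moved  = λ _ → subst (λ b → step b h′ ≢ h′) (sym (Bool.not-involutive t))
                     (λ eq → th≢h (trans (sym eq) (step-inv t h)))
        ; parity = λ {s} alt → trans (alt t h th≢h) (trans (cong not (parity alt)) (flip (s x) t))
        }
        where
        h′ : Fin N
        h′ = step t h

        old : ∀ {s} → s ∈ insert h′ S → s ≢ h′ → s ∈ S
        old s∈ s≢h′ = [ (λ s≡h′ → contradiction s≡h′ s≢h′) , id ]′ (∈insert⁻ s∈)

        closed′ : ∀ {s} → s ∈ S →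
          step (not t) s ∈ insert h′ S × step (not t) s ≢ h′ × step (not (not t)) s ∈ insert h′ S
        closed′ {s} s∈S =
          ∈insert⁺ (stays s∈S) ,
          (λ eq → fresh th≢h (subst (_∈ S) eq (stays s∈S))) ,
          subst (λ b → step b s ∈ insert h′ S) (sym (Bool.not-involutive t)) (forward (s ≟ h))
          where
          forward : Dec (s ≡ h) → step t s ∈ insert h′ S
          forward (yes refl) = z∈insert S
          forward (no s≢h)   = ∈insert⁺ (proj₁ (closed s∈S s≢h))

        inner′ : ∀ {s} → s ∈ S → s ≢ x → ∀ b → step b s ≢ s
        inner′ {s} s∈S s≢x with s ≟ h
        ... | yes refl = both (λ b → step b h ≢ h) t th≢h (moved s≢x)
        ... | no s≢h   = inner s∈S s≢x s≢h

        flip : ∀ c t → not (if t then c else not c) ≡ (if not t then c else not c)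
        flip c true  = refl
        flip c false = Bool.not-involutive c

      finish : step t h ≡ h → Component x
      finish th≡h = record
        { S      = S
        ; x∈S    = x∈S
        ; closed = λ b s∈S → both (λ b → step b _ ∈ S) t (onward s∈S) (stays s∈S) b
        ; end    = h
        ; ends   = λ b s∈S → ends b s∈S
        ; parity = λ alt v∈S v≢x fixed → atEnd alt (ends false v∈S fixed) v≢x fixed
        }
        where
        onward : ∀ {s} → s ∈ S → step t s ∈ S
        onward {s} s∈S with s ≟ h
        ... | yes refl = subst (_∈ S) (sym th≡h) h∈S
        ... | no s≢h   = proj₁ (closed s∈S s≢h)

        ends : ∀ b {s} → s ∈ S → step b s ≡ s → s ≡ x ⊎ s ≡ h
        ends b {s} s∈S fixed with s ≟ x | s ≟ h
        ... | yes s≡x | _       = inj₁ s≡x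
        ... | no _    | yes s≡h = inj₂ s≡h
        ... | no s≢x  | no s≢h  = contradiction fixed (inner s∈S s≢x s≢h b)

        -- The last edge traversed has kind `not t`; an end without a `false` edge was therefore
        -- reached by a `true` edge.
        arrived : ∀ t → step false h ≡ h → step (not t) h ≢ h → t ≡ false
        arrived false _     _     = refl
        arrived true  fixed moved = contradiction fixed moved

        atEnd : ∀ {s} → Alternating s → ∀ {v} → v ≡ x ⊎ v ≡ h → v ≢ x → step false v ≡ v → s v ≡ not (s x)
        atEnd alt (inj₁ v≡x)  v≢x fixed = contradiction v≡x v≢x
        atEnd {s} alt (inj₂ refl) v≢x fixed =
          trans (parity alt) (cong (λ t → if t then s x else not (s x)) (arrived t fixed (moved v≢x)))

    traverse : ∀ fuel {t h S} → N ≤ fuel + ∣ S ∣ → Path t h S → Component x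
    traverse fuel {t} {h} N≤ P with step t h ≟ h
    traverse fuel       N≤ P | yes th≡h = finish P th≡h
    traverse zero       {S = S} N≤ P | no th≢h = contradiction (exhausted S N≤ _) (fresh P th≢h)
    traverse (suc fuel) N≤ P | no th≢h =
      traverse fuel (insert-fuel (fresh P th≢h) N≤) (extend P th≢h)

    component : Component x
    component = traverse N (m≤m+n N _) unit

-- Transpositions of two colours

transpose-left : ∀ {n} (a b : Fin n) → transpose a b a ≡ b
transpose-left a b with a ≟ a
... | yes _  = refl
... | no a≢a = contradiction refl a≢a

transpose-right : ∀ {n} (a b : Fin n) → transpose a b b ≡ a
transpose-right a b with b ≟ a
... | yes b≡a = b≡a
... | no _ with b ≟ b
...   | yes _  = refl
...   | no b≢b = contradiction refl b≢b

transpose-other : ∀ {n} {a b c : Fin n} → c ≢ a → c ≢ b → transpose a b c ≡ c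
transpose-other {a = a} {b} {c} c≢a c≢b with c ≟ a
... | yes c≡a = contradiction c≡a c≢a
... | no _ with c ≟ b
...   | yes c≡b = contradiction c≡b c≢b
...   | no _    = refl

transpose-injective : ∀ {n} (a b : Fin n) {c d} → transpose a b c ≡ transpose a b d → c ≡ d
transpose-injective a b eq =
  trans (sym (transpose-inverse b a)) (trans (cong (transpose b a) eq) (transpose-inverse b a))

-- Vizing's theorem

module Vizing {N p : ℕ} (G : Graph N) where
  open Graph G using (adj; symm; irrefl)

  record Colouring : Set where
    field
      col     : Fin N → Fin N → Maybe (Fin p)
      col-sym : ∀ u v → col v u ≡ col u v
      proper  : ∀ {u v w a} → col u v ≡ just a → col u w ≡ just a → v ≡ w
      col-adj : ∀ {u v a} → col u v ≡ just a → adj u v ≡ true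

  open Colouring

  Coloured : Colouring → Fin N → Fin N → Set
  Coloured C u v = ∃ λ a → col C u v ≡ just a

  Free : Colouring → Fin p → Fin N → Set
  Free C a u = ∀ v → col C u v ≢ just a

  adj⇒≢ : ∀ {u v} → adj u v ≡ true → u ≢ v
  adj⇒≢ {u} uv refl = contradiction (trans (sym uv) (irrefl u)) λ ()

  nbr? : ∀ C a u → Dec (∃ λ v → col C u v ≡ just a)
  nbr? C a u = any? λ v → ≡-dec _≟_ (col C u v) (just a)

  -- If every colour occurred at `u`, counting the coloured edges at `u` by colour would give
  -- `p ≤ deg adj u`.
  free-colour : ∀ {u} → deg adj u < p → ∀ C → ∃ λ a → Free C a u
  free-colour {u} deg<p C with any? (λ a → all? (λ v → ¬? (≡-dec _≟_ (col C u v) (just a))))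
  ... | yes found = found
  ... | no none   = contradiction p≤deg (<⇒≱ deg<p)
    where
    open ≤-Reasoning
    is : Fin p → Fin N → ℕ
    is a v = 𝟙 (≡-dec _≟_ (col C u v) (just a))

    used : ∀ a → 1 ≤ sum (is a)
    used a with nbr? C a u
    ... | yes (v , uv) = ≤-trans (≤-reflexive (sym (𝟙-yes (≡-dec _≟_ (col C u v) (just a)) uv))) (term≤sum (is a) v)
    ... | no none′     = contradiction (a , λ v uv → none′ (v , uv)) none

    justAdj : ∀ v → ⟦ is-just (col C u v) ⟧ ≤ ⟦ adj u v ⟧
    justAdj v with col C u v in uv
    ... | nothing = z≤n
    ... | just a rewrite col-adj C uv = ≤-refl

    p≤deg : p ≤ deg adj u
    p≤deg = begin
      p                                 ≡⟨ trans (sum-const p 1) (*-identityʳ p) ⟨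
      sum {p} (λ _ → 1)                 ≤⟨ sum-mono used ⟩
      sum (λ a → sum (is a))            ≡⟨ ∑-comm is ⟩
      sum (λ v → sum (λ a → is a v))    ≡⟨ sum-cong-≗ (λ v → sum-𝟙-just (col C u v)) ⟩
      sum (λ v → ⟦ is-just (col C u v) ⟧) ≤⟨ sum-mono justAdj ⟩
      deg adj u                         ∎

  -- The colour class `a` as an involution on all vertices, the form that `Kempe` expects: its fixed
  -- points are exactly the vertices at which `a` is free.
  partner : Colouring → Fin p → Fin N → Fin N
  partner C a u with nbr? C a u
  ... | yes (v , _) = v
  ... | no _        = u

  partner-nbr : ∀ C {a u v} → col C u v ≡ just a → partner C a u ≡ v
  partner-nbr C {a} {u} uv with nbr? C a u
  ... | yes (w , uw) = proper C uw uv
  ... | no none      = contradiction (_ , uv) none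

  partner-free : ∀ C {a u} → Free C a u → partner C a u ≡ u
  partner-free C {a} {u} free with nbr? C a u
  ... | yes (w , uw) = contradiction uw (free w)
  ... | no _         = refl

  partner-inv : ∀ C a u → partner C a (partner C a u) ≡ u
  partner-inv C a u with nbr? C a u
  ... | yes (v , uv) = partner-nbr C (trans (col-sym C u v) uv)
  ... | no none      = partner-free C λ v uv → none (v , uv)

  module Swap (C : Colouring) {a b : Fin p} (a≢b : a ≢ b) {x : Fin N} (a-free : Free C a x) where

    step : Bool → Fin N → Fin N
    step false = partner C a
    step true  = partner C b

    step-inv : ∀ c u → step c (step c u) ≡ u
    step-inv false = partner-inv C a
    step-inv true  = partner-inv C b

    open Kempe step step-inv using (Component; component)
    open Component (component (partner-free C a-free)) public using (S; x∈S; closed; end; ends)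

    τ : Fin p → Fin p
    τ = transpose a b

    swapped : Fin N → Fin N → Maybe (Fin p)
    swapped u v with u ∈? S
    ... | yes _ = Maybe.map τ (col C u v)
    ... | no _  = col C u v

    swapped-in : ∀ {u} → u ∈ S → ∀ v → swapped u v ≡ Maybe.map τ (col C u v)
    swapped-in {u} u∈S v with u ∈? S
    ... | yes _  = refl
    ... | no u∉S = contradiction u∈S u∉S

    swapped-out : ∀ {u} → u ∉ S → ∀ v → swapped u v ≡ col C u v
    swapped-out {u} u∉S v with u ∈? S
    ... | yes u∈S = contradiction u∈S u∉S
    ... | no _    = refl

    swapped-other : ∀ u v {c} → c ≢ a → c ≢ b → col C u v ≡ just c → swapped u v ≡ just c
    swapped-other u v c≢a c≢b uv with u ∈? S
    ... | yes _ = trans (cong (Maybe.map τ) uv) (cong just (transpose-other c≢a c≢b))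
    ... | no _  = uv

    swapped-nothing : ∀ u v → col C u v ≡ nothing → swapped u v ≡ nothing
    swapped-nothing u v uv with u ∈? S
    ... | yes _ = cong (Maybe.map τ) uv
    ... | no _  = uv

    swapped-just : ∀ u v {c} → col C u v ≡ just c → ∃ λ d → swapped u v ≡ just d
    swapped-just u v uv with u ∈? S
    ... | yes _ = _ , cong (Maybe.map τ) uv
    ... | no _  = _ , uv

    leave : ∀ {u v c} → c ≡ a ⊎ c ≡ b → col C u v ≡ just c → u ∈ S → v ∈ S
    leave (inj₁ refl) uv u∈S = subst (_∈ S) (partner-nbr C uv) (closed false u∈S)
    leave (inj₂ refl) uv u∈S = subst (_∈ S) (partner-nbr C uv) (closed true u∈S)

    -- `swapped` consults the first endpoint only. This is symmetric since an edge coloured `a` or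
    -- `b` has both ends in `S` or neither, and `τ` fixes every other colour.
    swapped-sym : ∀ u v → swapped v u ≡ swapped u v
    swapped-sym u v with col C u v in uv
    ... | nothing = trans (swapped-nothing v u (trans (col-sym C u v) uv)) (sym (swapped-nothing u v uv))
    ... | just c  = byColour (c ≟ a) (c ≟ b)
      where
      vu : col C v u ≡ just c
      vu = trans (col-sym C u v) uv

      inPair : c ≡ a ⊎ c ≡ b → swapped v u ≡ swapped u v
      inPair c∈ab with u ∈? S
      ... | yes u∈S = trans (swapped-in (leave c∈ab uv u∈S) u) (cong (Maybe.map τ) (col-sym C u v))
      ... | no u∉S  = trans (swapped-out (λ v∈S → u∉S (leave c∈ab vu v∈S)) u) (col-sym C u v)

      byColour : Dec (c ≡ a) → Dec (c ≡ b) → swapped v u ≡ swapped u v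
      byColour (yes c≡a) _         = inPair (inj₁ c≡a)
      byColour (no _)    (yes c≡b) = inPair (inj₂ c≡b)
      byColour (no c≢a)  (no c≢b)  =
        trans (swapped-other v u c≢a c≢b vu) (sym (swapped-other u v c≢a c≢b uv))

    map-just : ∀ m {c} → Maybe.map τ m ≡ just c → ∃ λ d → m ≡ just d × τ d ≡ c
    map-just (just d) refl = d , refl , refl

    C′ : Colouring
    C′ = record
      { col     = swapped
      ; col-sym = swapped-sym
      ; proper  = λ {u} → proper′ {u}
      ; col-adj = λ {u} → adj′ {u}
      }
      where
      proper′ : ∀ {u v w c} → swapped u v ≡ just c → swapped u w ≡ just c → v ≡ w
      proper′ {u} {v} {w} uv uw with u ∈? S
      ... | no _  = proper C uv uw
      ... | yes _ with (d , uv′ , refl) ← map-just (col C u v) uv | (d′ , uw′ , eq) ← map-just (col C u w) uw =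
        proper C uv′ (trans uw′ (cong just (transpose-injective a b eq)))

      adj′ : ∀ {u v c} → swapped u v ≡ just c → adj u v ≡ true
      adj′ {u} {v} uv with u ∈? S
      ... | no _  = col-adj C uv
      ... | yes _ with (d , uv′ , _) ← map-just (col C u v) uv = col-adj C uv′

    free-in : ∀ {u c} → u ∈ S → Free C c u → Free C′ (τ c) u
    free-in {u} u∈S free v uv with (d , uv′ , eq) ← map-just (col C u v) (trans (sym (swapped-in u∈S v)) uv) =
      free v (trans uv′ (cong just (transpose-injective a b eq)))

    free-out : ∀ {u c} → u ∉ S → Free C c u → Free C′ c u
    free-out u∉S free v uv = free v (trans (sym (swapped-out u∉S v)) uv)

    free-other : ∀ {u c} → c ≢ a → c ≢ b → Free C c u → Free C′ c u
    free-other {u} c≢a c≢b free = case u ∈? S of λ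
      { (yes u∈S) → subst (λ d → Free C′ d u) (transpose-other c≢a c≢b) (free-in u∈S free)
      ; (no u∉S)  → free-out u∉S free
      }

    b-free : Free C′ b x
    b-free = subst (λ d → Free C′ d x) (transpose-left a b) (free-in x∈S a-free)

    -- A vertex of `S` without a `b` edge is an end of the path, so besides `x` there is at most one
    -- of them.
    b-ends : ∀ {u} → u ∈ S → Free C b u → u ≡ x ⊎ u ≡ end
    b-ends u∈S free = ends true u∈S (partner-free C free)

  module Recolour (C : Colouring) {x z : Fin N} (xz-adj : adj x z ≡ true)
                  {d : Fin p} (d-free-x : Free C d x) (d-free-z : Free C d z) where

    Edge : Fin N → Fin N → Set
    Edge u v = (u ≡ x × v ≡ z) ⊎ (u ≡ z × v ≡ x)

    edge? : ∀ u v → Dec (Edge u v)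
    edge? u v = ((u ≟ x) ×-dec (v ≟ z)) ⊎-dec ((u ≟ z) ×-dec (v ≟ x))

    recoloured : Fin N → Fin N → Maybe (Fin p)
    recoloured u v with edge? u v
    ... | yes _ = just d
    ... | no _  = col C u v

    on : ∀ {u v} → Edge u v → recoloured u v ≡ just d
    on {u} {v} uv with edge? u v
    ... | yes _  = refl
    ... | no ¬uv = contradiction uv ¬uv

    off : ∀ {u v} → ¬ Edge u v → recoloured u v ≡ col C u v
    off {u} {v} ¬uv with edge? u v
    ... | yes uv = contradiction uv ¬uv
    ... | no _   = refl

    edge-sym : ∀ {u v} → Edge u v → Edge v u
    edge-sym (inj₁ (p , q)) = inj₂ (q , p)
    edge-sym (inj₂ (p , q)) = inj₁ (q , p)

    edge-unique : ∀ {u v w} → Edge u v → Edge u w → v ≡ w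
    edge-unique (inj₁ (_ , refl))    (inj₁ (_ , refl)) = refl
    edge-unique (inj₂ (_ , refl))    (inj₂ (_ , refl)) = refl
    edge-unique (inj₁ (refl , refl)) (inj₂ (x≡z , _))  = contradiction x≡z (adj⇒≢ xz-adj)
    edge-unique (inj₂ (refl , refl)) (inj₁ (z≡x , _))  = contradiction (sym z≡x) (adj⇒≢ xz-adj)

    edge-free : ∀ {u v} → Edge u v → Free C d u
    edge-free (inj₁ (refl , _)) = d-free-x
    edge-free (inj₂ (refl , _)) = d-free-z

    C′ : Colouring
    C′ = record { col = recoloured ; col-sym = sym′ ; proper = λ {u} → proper′ {u} ; col-adj = λ {u} → adj′ {u} }
      where
      sym′ : ∀ u v → recoloured v u ≡ recoloured u v
      sym′ u v with edge? u v
      ... | yes uv = on (edge-sym uv)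
      ... | no ¬uv = trans (off (¬uv ∘ edge-sym)) (col-sym C u v)

      proper′ : ∀ {u v w c} → recoloured u v ≡ just c → recoloured u w ≡ just c → v ≡ w
      proper′ {u} {v} {w} uv uw with edge? u v | edge? u w
      ... | yes e  | yes e′ = edge-unique e e′
      ... | yes e  | no _   = contradiction (trans uw (sym uv)) (edge-free e w)
      ... | no _   | yes e′ = contradiction (trans uv (sym uw)) (edge-free e′ v)
      ... | no _   | no _   = proper C uv uw

      adj′ : ∀ {u v c} → recoloured u v ≡ just c → adj u v ≡ true
      adj′ {u} {v} uv with edge? u v
      ... | no _ = col-adj C uv
      ... | yes (inj₁ (refl , refl)) = xz-adj
      ... | yes (inj₂ (refl , refl)) = trans (symm x z) xz-adj

    keeps : ∀ {u v} → Coloured C u v → Coloured C′ u v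
    keeps {u} {v} uv with edge? u v
    ... | yes _ = d , refl
    ... | no _  = uv

    free-away : ∀ {u c} → u ≢ x → u ≢ z → Free C c u → Free C′ c u
    free-away {u} u≢x u≢z free v uv =
      free v (trans (sym (off {u} {v} λ { (inj₁ (u≡x , _)) → u≢x u≡x ; (inj₂ (u≡z , _)) → u≢z u≡z })) uv)

    -- This keeps a rotation going: the colour given up by the edge from `x` to `z` becomes
    -- available for the edge from `x` to the preceding fan vertex.
    released : ∀ {c} → col C x z ≡ just c → Free C′ c x
    released {c} xz v xv with edge? x v
    ... | yes _ = d-free-x z (trans xz (sym xv))
    ... | no ¬e = ¬e (inj₁ (refl , proper C xv xz))

    elsewhere : ∀ {v} → v ≢ z → recoloured x v ≡ col C x v
    elsewhere v≢z = off λ { (inj₁ (_ , v≡z)) → v≢z v≡z ; (inj₂ (x≡z , _)) → adj⇒≢ xz-adj x≡z }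

  Extension : Colouring → Fin N → Fin N → Set
  Extension C x y = Σ Colouring λ C′ → (∀ {u v} → Coloured C u v → Coloured C′ u v) × Coloured C′ x y

  module _ {x y : Fin N} (xy-adj : adj x y ≡ true) where

    -- A fan at x whose first vertex is y, with vertex set F and last vertex z.
    data Fan (C : Colouring) : Fin N → Subset N → Set where
      start : Fan C y ⁅ y ⁆
      add   : ∀ {g F z c} → Fan C g F → z ∉ F → col C x z ≡ just c → Free C c g → Fan C z (insert z F)

    last∈ : ∀ {C z F} → Fan C z F → z ∈ F
    last∈ start             = x∈⁅x⁆ y
    last∈ (add {F = F} _ _ _ _) = z∈insert F

    x∉fan : ∀ {C z F} → Fan C z F → x ∉ F
    x∉fan start x∈ = adj⇒≢ xy-adj (x∈⁅y⁆⇒x≡y y x∈)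
    x∉fan {C} (add fan _ xz _) x∈ with ∈insert⁻ x∈
    ... | inj₁ x≡z = adj⇒≢ (col-adj C xz) x≡z
    ... | inj₂ x∈F = x∉fan fan x∈F

    -- Induction from the last fan vertex back to `y`: its edge takes `d` and releases its old
    -- colour, which is free at the preceding vertex, and so on until the edge from `x` to `y` is
    -- coloured. The fan refers to a fixed `C₀` while `C` changes; it suffices that `C` agrees with
    -- `C₀` on the remaining fan edges and keeps the free colours of the remaining fan vertices.
    rotate : ∀ {C₀ z F d} C → Fan C₀ z F → (∀ {v} → v ∈ F → col C x v ≡ col C₀ x v) →
             (∀ {u c} → u ∈ F → Free C₀ c u → Free C c u) →
             Free C d x → Free C d z → Extension C x y
    rotate {d = d} C start same frees dx dz = C′ , keeps , d , on (inj₁ (refl , refl))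
      where open Recolour C xy-adj dx dz
    rotate {z = z} C (add {F = F} {c = c} fan z∉F xz₀ free) same frees dx dz =
      let g∈F             = last∈ fan
          D , kept , done = rotate C′ fan
            (λ v∈F → trans (elsewhere (awayᶻ v∈F)) (same (∈insert⁺ v∈F)))
            (λ u∈F → free-away (awayˣ u∈F) (awayᶻ u∈F) ∘ frees (∈insert⁺ u∈F))
            (released xz) (free-away (awayˣ g∈F) (awayᶻ g∈F) (frees (∈insert⁺ g∈F) free))
      in D , kept ∘ keeps , done
      where
      xz : col C x z ≡ just c
      xz = trans (same (z∈insert F)) xz₀
      open Recolour C (col-adj C xz) dx dz
      awayˣ : ∀ {u} → u ∈ F → u ≢ x
      awayˣ u∈F refl = x∉fan fan u∈F
      awayᶻ : ∀ {u} → u ∈ F → u ≢ z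
      awayᶻ u∈F refl = z∉F u∈F

    module _ (C : Colouring) {a b : Fin p} (a≢b : a ≢ b) (a-free : Free C a x)
             (xy : col C x y ≡ nothing) where
      open Swap C a≢b a-free

      -- Swapping preserves the fan, unless the vertex before the b-edge lies outside
      -- the component of x; the fan up to that vertex then survives.
      swap-fan : ∀ {z F} → Fan C z F →
        (Fan C′ z F × (∀ {v} → v ∈ F → col C x v ≡ just b → ∃ λ g → g ∈ F × g ≢ z × g ∈ S × Free C b g)) ⊎
        (∃ λ g → ∃ λ F′ → Fan C′ g F′ × g ∉ S × Free C b g)
      swap-fan start = inj₁ (start , λ v∈ xv → contradiction (trans (sym xv) (trans (cong (col C x) (x∈⁅y⁆⇒x≡y y v∈)) xy)) λ ())
      swap-fan (add {g} {F} {z} {c} fan z∉F xz free) with swap-fan fan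
      ... | inj₂ short = inj₂ short
      ... | inj₁ (fan′ , before) with c ≟ b
      ...   | no c≢b = inj₁ (add fan′ z∉F (swapped-other x z c≢a c≢b xz) (free-other c≢a c≢b free) , before′)
        where
        c≢a : c ≢ a
        c≢a refl = a-free z xz
        before′ : ∀ {v} → v ∈ insert z F → col C x v ≡ just b → ∃ λ g → g ∈ insert z F × g ≢ z × g ∈ S × Free C b g
        before′ v∈ xv with ∈insert⁻ v∈
        ... | inj₁ refl = contradiction (just-injective (trans (sym xz) xv)) c≢b
        ... | inj₂ v∈F with (g , g∈F , _ , g∈S , gb) ← before v∈F xv =
          g , ∈insert⁺ g∈F , (λ { refl → z∉F g∈F }) , g∈S , gb
      ...   | yes refl with g ∈? S
      ...     | no g∉S  = inj₂ (g , F , fan′ , g∉S , free)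
      -- Both `x` and `g` are in `S`, so the edge from `x` to `z` turns from `b` to `a` and the
      -- colour free at `g` turns from `b` to `a` along with it: the fan condition persists.
      ...     | yes g∈S = inj₁ (add fan′ z∉F
                  (trans (swapped-in x∈S z) (trans (cong (Maybe.map τ) xz) (cong just (transpose-right a b))))
                  (subst (λ e → Free C′ e g) (transpose-right a b) (free-in g∈S free)) ,
                λ _ _ → g , ∈insert⁺ (last∈ fan) , (λ { refl → z∉F (last∈ fan) }) , g∈S , free)

      -- The swap makes `b` free at `x`. If the fan is cut at some `g` outside `S`, then `b` is
      -- still free at `g`. Otherwise some `g` other than `z` lies in `S` with `b` free there, so it
      -- occupies the only end of the path besides `x`; hence `z` is outside `S` and keeps `b` free.
      -- Either way a rotation with `b` finishes.
      kempe-step : ∀ {z F} → Fan C z F → Free C b z →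
                   ∀ {v} → v ∈ F → col C x v ≡ just b → Extension C x y
      kempe-step fan bz v∈F xv = through (choose (swap-fan fan))
        where
        through : Extension C′ x y → Extension C x y
        through (D , kept , done) = D , (λ {u} {v} (_ , uv) → kept (swapped-just u v uv)) , done
        choose : _ → Extension C′ x y
        choose (inj₂ (g , F′ , fan′ , g∉S , gb)) = rotate C′ fan′ (λ _ → refl) (λ _ → id) b-free (free-out g∉S gb)
        choose (inj₁ (fan′ , before)) with (g , g∈F , g≢z , g∈S , gb) ← before v∈F xv =
          rotate C′ fan′ (λ _ → refl) (λ _ → id) b-free (free-out z∉S bz)
          where
          z∉S : _ ∉ S
          z∉S z∈S with b-ends z∈S bz | b-ends g∈S gb
          ... | inj₁ refl  | _          = x∉fan fan (last∈ fan)
          ... | inj₂ _     | inj₁ refl  = x∉fan fan g∈F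
          ... | inj₂ z≡end | inj₂ g≡end = g≢z (trans g≡end (sym z≡end))

    module _ (deg<p : ∀ u → deg adj u < p) (C : Colouring) (xy : col C x y ≡ nothing) where

      -- Take `b` free at the last fan vertex. If `b` is free at `x` too, rotate; if the `b` edge at
      -- `x` leads into the fan, apply a Kempe swap; otherwise its other end extends the fan.
      grow : ∀ fuel {z F} → N ≤ fuel + ∣ F ∣ → Fan C z F → Extension C x y
      grow fuel {z} {F} N≤ fan with free-colour (deg<p z) C
      ... | b , bz with nbr? C b x
      ...   | no none = rotate C fan (λ _ → refl) (λ _ → id) (λ v xv → none (v , xv)) bz
      ...   | yes (v , xv) with v ∈? F
      ...     | yes v∈F with (a , a-free) ← free-colour (deg<p x) C =
        kempe-step C (λ { refl → a-free v xv }) a-free xy fan bz v∈F xv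
      grow zero       N≤ fan | b , bz | yes (v , xv) | no v∉F = contradiction (exhausted _ N≤ v) v∉F
      grow (suc fuel) N≤ fan | b , bz | yes (v , xv) | no v∉F =
        grow fuel (insert-fuel v∉F N≤) (add fan v∉F xv bz)

  module _ (deg<p : ∀ u → deg adj u < p) where

    colour-pair : ∀ C u v → Σ Colouring λ C′ →
      (∀ {u v} → Coloured C u v → Coloured C′ u v) × (adj u v ≡ true → Coloured C′ u v)
    colour-pair C u v with col C u v in uv | adj u v in uv-adj
    ... | just a  | _     = C , id , λ _ → a , uv
    ... | nothing | false = C , id , λ ()
    ... | nothing | true with (D , kept , done) ← grow uv-adj deg<p C uv N (m≤m+n N _) (start) =
      D , kept , λ _ → done

    colour-pairs : ∀ L → Σ Colouring λ C → ∀ {u v} → (u , v) ∈ᴸ L → adj u v ≡ true → Coloured C u v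
    colour-pairs []            = record { col = λ _ _ → nothing ; col-sym = λ _ _ → refl ; proper = λ () ; col-adj = λ () } , λ ()
    colour-pairs ((u , v) ∷ L) with (C , done) ← colour-pairs L with (D , kept , new) ← colour-pair C u v =
      D , λ { (here refl) → new ; (there uv∈L) → kept ∘ done uv∈L }

    vizing : Σ Colouring λ C → ∀ u v → adj u v ≡ true → Coloured C u v
    vizing with (C , done) ← colour-pairs (cartesianProduct (allFin N) (allFin N)) =
      C , λ u v → done (∈-cartesianProduct⁺ (∈-allFin u) (∈-allFin v))

-- Orienting pairs of colour classes

private
  flip-not : ∀ {b c} → b ≡ not c → c ≡ not b
  flip-not {c = c} refl = sym (Bool.not-involutive c)

module _ {N : ℕ} (step : Bool → Fin N → Fin N) (step-inv : ∀ b u → step b (step b u) ≡ u) where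
  open Kempe step step-inv

  -- If `u` and `v` are on the same side, `parity` shows that `v` is not in the component of `u`;
  -- flipping `s` on that component keeps it alternating and separates the two.
  separate : ∀ {s} → Alternating s → ∀ {u v} → step false u ≡ u → step false v ≡ v → u ≢ v →
             ∃ λ s′ → Alternating s′ × s′ v ≡ not (s′ u)
  separate {s} alt {u} {v} u-fixed v-fixed u≢v with s v Bool.≟ not (s u)
  ... | yes differ = s , alt , differ
  ... | no ¬differ = s′ , alt′ , trans (s′-out v∉S) (trans same (sym (trans (cong not (s′-in x∈S)) (Bool.not-involutive (s u)))))
    where
    open Component (component u-fixed)

    v∉S : v ∉ S
    v∉S v∈S = ¬differ (parity alt v∈S (u≢v ∘ sym) v-fixed)

    same : s v ≡ s u
    same = trans (Bool.¬-not ¬differ) (Bool.not-involutive (s u))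

    s′ : Fin N → Bool
    s′ w = if does (w ∈? S) then not (s w) else s w

    s′-in : ∀ {w} → w ∈ S → s′ w ≡ not (s w)
    s′-in {w} w∈S rewrite dec-true (w ∈? S) w∈S = refl

    s′-out : ∀ {w} → w ∉ S → s′ w ≡ s w
    s′-out {w} w∉S rewrite dec-false (w ∈? S) w∉S = refl

    alt′ : Alternating s′
    alt′ b w moved = case w ∈? S of λ
      { (yes w∈S) → trans (s′-in (closed b w∈S)) (cong not (trans (alt b w moved) (sym (s′-in w∈S))))
      ; (no w∉S)  → trans (s′-out (λ bw∈S → w∉S (subst (_∈ S) (step-inv b w) (closed b bw∈S))))
                      (trans (alt b w moved) (cong not (sym (s′-out w∉S))))
      }

module Bipartition {N : ℕ} (φ ψ : Fin N → Fin N) (φ-inv : ∀ u → φ (φ u) ≡ u) (ψ-inv : ∀ u → ψ (ψ u) ≡ u) where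
  open DecMembership (_≟_ {N}) using () renaming (_∈?_ to _∈ᴸ?_)

  Flips : (Fin N → Fin N) → (Fin N → Bool) → Fin N → Set
  Flips f s u = f u ≢ u → s (f u) ≡ not (s u)

  -- The `φ` edge at `u` has an end in `L`. Asking for either end makes the restriction of `φ` to
  -- these vertices an involution again.
  Touched : List (Fin N) → Fin N → Set
  Touched L u = u ∈ᴸ L ⊎ φ u ∈ᴸ L

  touched? : ∀ L u → Dec (Touched L u)
  touched? L u = (u ∈ᴸ? L) ⊎-dec (φ u ∈ᴸ? L)

  touched-φ : ∀ {L u} → Touched L u → Touched L (φ u)
  touched-φ {L} {u} (inj₁ u∈L)  = inj₂ (subst (_∈ᴸ L) (sym (φ-inv u)) u∈L)
  touched-φ         (inj₂ φu∈L) = inj₁ φu∈L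

  module _ (L : List (Fin N)) where

    step : Bool → Fin N → Fin N
    step true  u = ψ u
    step false u = if does (touched? L u) then φ u else u

    step-touched : ∀ {u} → Touched L u → step false u ≡ φ u
    step-touched {u} t rewrite dec-true (touched? L u) t = refl

    step-untouched : ∀ {u} → ¬ Touched L u → step false u ≡ u
    step-untouched {u} ¬t rewrite dec-false (touched? L u) ¬t = refl

    step-inv : ∀ b u → step b (step b u) ≡ u
    step-inv true  u = ψ-inv u
    step-inv false u = case touched? L u of λ
      { (yes t) → trans (cong (step false) (step-touched t)) (trans (step-touched (touched-φ t)) (φ-inv u))
      ; (no ¬t) → trans (cong (step false) (step-untouched ¬t)) (step-untouched ¬t)
      }

    open Kempe step step-inv using (Alternating)

    touched-flips : ∀ {s} → (∀ {u} → u ∈ᴸ L → Flips φ s u) → ∀ {u} → Touched L u → Flips φ s u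
    touched-flips         φ-flips     (inj₁ u∈L)  moved = φ-flips u∈L moved
    touched-flips {s = s} φ-flips {u} (inj₂ φu∈L) moved =
      flip-not (trans (cong s (sym (φ-inv u))) (φ-flips φu∈L λ eq → moved (trans (sym eq) (φ-inv u))))

    alternating : ∀ {s} → (∀ {u} → u ∈ᴸ L → Flips φ s u) → (∀ u → Flips ψ s u) → Alternating s
    alternating     φ-flips ψ-flips true  u moved = ψ-flips u moved
    alternating {s} φ-flips ψ-flips false u moved = case touched? L u of λ
      { (no ¬t) → contradiction (step-untouched ¬t) moved
      ; (yes t) → subst (λ w → s w ≡ not (s u)) (sym (step-touched t))
                    (touched-flips {s} φ-flips t (subst (_≢ u) (step-touched t) moved))
      }

  -- The edges of `φ` are added one at a time. Before its edge is added, `u` and `φ u` are both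
  -- fixed by `step L false`, so `separate` can put them on opposite sides without disturbing `ψ` or
  -- the earlier edges. This is the bipartiteness of a union of two matchings.
  process : ∀ L → ∃ λ s → (∀ {u} → u ∈ᴸ L → Flips φ s u) × (∀ u → Flips ψ s u)
  -- With no edge of `φ` to respect yet, each pair of `ψ` is split by comparing indices.
  process [] = (λ u → does (toℕ u <? toℕ (ψ u))) , (λ ()) , ordered
    where
    ordered : ∀ u → Flips ψ (λ u → does (toℕ u <? toℕ (ψ u))) u
    ordered u moved rewrite ψ-inv u with <-cmp (toℕ u) (toℕ (ψ u))
    ... | tri< u<ψu _ ψu≮u rewrite dec-true (toℕ u <? toℕ (ψ u)) u<ψu | dec-false (toℕ (ψ u) <? toℕ u) ψu≮u = refl
    ... | tri> u≮ψu _ ψu<u rewrite dec-false (toℕ u <? toℕ (ψ u)) u≮ψu | dec-true (toℕ (ψ u) <? toℕ u) ψu<u = refl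
    ... | tri≈ _ u≡ψu _ = contradiction (sym (toℕ-injective u≡ψu)) moved
  process (u ∷ L) with process L
  ... | s , φ-flips , ψ-flips with φ u ≟ u | touched? L u
  ...   | yes fixed | _ = s , (λ { (here refl) moved → contradiction fixed moved ; (there w∈L) → φ-flips w∈L }) , ψ-flips
  ...   | no _ | yes t = s , (λ { (here refl) → touched-flips L {s} φ-flips t ; (there w∈L) → φ-flips w∈L }) , ψ-flips
  ...   | no φu≢u | no ¬t
    with (s′ , alt , differ) ← separate (step L) (step-inv L) (alternating L φ-flips ψ-flips)
           (step-untouched L ¬t)
           (step-untouched L (λ t → ¬t (subst (Touched L) (φ-inv u) (touched-φ t)))) (φu≢u ∘ sym) =
      s′ ,
      (λ { (here refl) _ → differ
         ; (there {xs = L} w∈L) moved → subst (λ w → s′ w ≡ not (s′ _)) (step-touched L (inj₁ w∈L))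
             (alt false _ (subst (_≢ _) (sym (step-touched L (inj₁ w∈L))) moved)) }) ,
      alt true

  bipartition : ∃ λ s → (∀ u → Flips φ s u) × (∀ u → Flips ψ s u)
  bipartition with (s , φ-flips , ψ-flips) ← process (allFin N) = s , (λ u → φ-flips (∈-allFin u)) , ψ-flips

-- Labels as colours, and labellings from colourings

module _ {m n : ℕ} where

  -- `2 * m` unfolds to `m + (m + 0)`, which accounts for the `↑ˡ 0` and for the impossible third
  -- case in decoding.
  encode : Label m n → Fin (2 * m + n)
  encode (arc⁺ i) = (i ↑ˡ (m + 0)) ↑ˡ n
  encode (arc⁻ i) = (m ↑ʳ (i ↑ˡ 0)) ↑ˡ n
  encode (edge j) = (2 * m) ↑ʳ j

  decodeArc : Fin m ⊎ Fin (m + 0) → Label m n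
  decodeArc (inj₁ i) = arc⁺ i
  decodeArc (inj₂ i) with splitAt m i
  ... | inj₁ j = arc⁻ j

  decode : Fin (2 * m + n) → Label m n
  decode c = [ (λ a → decodeArc (splitAt m a)) , edge ]′ (splitAt (2 * m) c)

  decode-encode : ∀ l → decode (encode l) ≡ l
  decode-encode (arc⁺ i) rewrite splitAt-↑ˡ (2 * m) (i ↑ˡ (m + 0)) n | splitAt-↑ˡ m i (m + 0) = refl
  decode-encode (arc⁻ i) rewrite splitAt-↑ˡ (2 * m) (m ↑ʳ (i ↑ˡ 0)) n | splitAt-↑ʳ m (m + 0) (i ↑ˡ 0) | splitAt-↑ˡ m i 0 = refl
  decode-encode (edge j) rewrite splitAt-↑ʳ (2 * m) n j = refl

  encode-decode : ∀ c → encode (decode c) ≡ c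
  encode-decode c with splitAt (2 * m) c | join-splitAt (2 * m) n c
  ... | inj₂ j | eq = eq
  ... | inj₁ a | refl with splitAt m a | join-splitAt m (m + 0) a
  ...   | inj₁ i | refl = refl
  ...   | inj₂ k | refl with splitAt m k | join-splitAt m 0 k
  ...     | inj₁ i | refl = refl

  encode-injective : ∀ {k l} → encode k ≡ encode l → k ≡ l
  encode-injective {k} {l} eq = trans (sym (decode-encode k)) (trans (cong decode eq) (decode-encode l))

  decode-injective : ∀ {c d} → decode c ≡ decode d → c ≡ d
  decode-injective {c} {d} eq = trans (sym (encode-decode c)) (trans (cong encode eq) (encode-decode d))

  -- Two colour classes become one arc type: s alternates along their union, so orienting both classes
  -- by s makes one incoming and the other outgoing at every vertex.
  module _ {N : ℕ} (G : Graph N) (C : Vizing.Colouring {p = 2 * m + n} G) where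
    open Graph G using (adj)
    open Vizing {p = 2 * m + n} G
    open Colouring C

    private
      module B (i : Fin m) = Bipartition (partner C (encode (arc⁺ i))) (partner C (encode (arc⁻ i)))
                               (partner-inv C _) (partner-inv C _)

      side : Fin m → Fin N → Bool
      side i = proj₁ (B.bipartition i)

      -- Arc signs are kept on the `true` side and exchanged on the `false` side. Each `orient u` is
      -- an involution on labels, so distinct colours at `u` give distinct labels.
      orient : Fin N → Label m n → Label m n
      orient u (arc⁺ i) = if side i u then arc⁺ i else arc⁻ i
      orient u (arc⁻ i) = if side i u then arc⁻ i else arc⁺ i
      orient u (edge j) = edge j

      orient-injective : ∀ u {k l} → orient u k ≡ orient u l → k ≡ l
      orient-injective u {k} {l} eq = trans (sym (involutive k)) (trans (cong (orient u) eq) (involutive l))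
        where
        involutive : ∀ l → orient u (orient u l) ≡ l
        involutive (edge j) = refl
        involutive (arc⁺ i) with side i u in eq
        ... | true  rewrite eq = refl
        ... | false rewrite eq = refl
        involutive (arc⁻ i) with side i u in eq
        ... | true  rewrite eq = refl
        ... | false rewrite eq = refl

      -- The ends of an edge in either of two paired classes lie on opposite sides, so exactly one
      -- of them exchanges the sign.
      orient-reverse : ∀ {u v} l → col u v ≡ just (encode l) → orient v l ≡ reverse (orient u l)
      orient-reverse (edge j) uv = refl
      orient-reverse {u} {v} (arc⁺ i) uv
        rewrite subst (λ w → w ≢ u → side i w ≡ not (side i u)) (partner-nbr C uv)
                  (proj₁ (proj₂ (B.bipartition i)) u) (adj⇒≢ (col-adj uv) ∘ sym)
        with side i u
      ... | true  = refl
      ... | false = refl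
      orient-reverse {u} {v} (arc⁻ i) uv
        rewrite subst (λ w → w ≢ u → side i w ≡ not (side i u)) (partner-nbr C uv)
                  (proj₂ (proj₂ (B.bipartition i)) u) (adj⇒≢ (col-adj uv) ∘ sym)
        with side i u
      ... | true  = refl
      ... | false = refl

      label : Fin N → Fin N → Maybe (Label m n)
      label u v = Maybe.map (orient u ∘ decode) (col u v)

    oriented : MNGraph m n N
    oriented = record { σ = label ; σ-rev = rev ; σ-irrefl = irr }
      where
      rev : ∀ u v → label v u ≡ Maybe.map reverse (label u v)
      rev u v rewrite col-sym u v with col u v in uv
      ... | nothing = refl
      ... | just c  = cong just (orient-reverse (decode c) (trans uv (cong just (sym (encode-decode c)))))

      irr : ∀ u → label u u ≡ nothing
      irr u with col u u in uu
      ... | nothing = refl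
      ... | just c  = contradiction refl (adj⇒≢ (col-adj uu))

    oriented-und : (∀ u v → adj u v ≡ true → Coloured C u v) → ∀ u v → is-just (label u v) ≡ adj u v
    oriented-und total u v with col u v in uv | adj u v in uv-adj
    ... | just c  | true  = refl
    ... | nothing | false = refl
    ... | just c  | false = trans (sym (col-adj uv)) uv-adj
    ... | nothing | true  = case trans (sym uv) (proj₂ (total u v uv-adj)) of λ ()

    -- The purpose of the orientation: all labels at `w` differ, so every 2-path between distinct
    -- vertices is special.
    oriented-proper : ∀ {w u v l} → label w u ≡ just l → label w v ≡ just l → u ≡ v
    oriented-proper {w} {u} {v} wu wv with col w u in cu | col w v in cv
    ... | just c | just d = proper cu (trans cv (cong just (sym c≡d)))
      where
      c≡d : c ≡ d
      c≡d = decode-injective (orient-injective w {decode c} {decode d} (just-injective (trans wu (sym wv))))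

-- Relative and absolute cliques

module _ {m n : ℕ} where

  _≟ᴸ_ : DecidableEquality (Label m n)
  k ≟ᴸ l = map′ encode-injective (cong encode) (encode k ≟ encode l)

  reverse-involutive : (l : Label m n) → reverse (reverse l) ≡ l
  reverse-involutive (arc⁺ i) = refl
  reverse-involutive (arc⁻ i) = refl
  reverse-involutive (edge j) = refl

  Labelling : ℕ → Set
  Labelling N = Fin N → Fin N → Maybe (Label m n)

  adjOf : ∀ {N} → Labelling N → Fin N → Fin N → Bool
  adjOf σ u v = is-just (σ u v)

  data Clash : Maybe (Label m n) → Maybe (Label m n) → Set where
    clash : ∀ {k l} → k ≢ l → Clash (just k) (just l)

  clash? : ∀ x y → Dec (Clash x y)
  clash? nothing  _        = no λ ()
  clash? (just _) nothing  = no λ ()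
  clash? (just k) (just l) = map′ clash (λ { (clash k≢l) → k≢l }) (¬? (k ≟ᴸ l))

  -- No homomorphism identifies u and v: they are adjacent or joined by a special 2-path.
  Special : ∀ {N} → Labelling N → Fin N → Fin N → Set
  Special σ u v = adjOf σ u v ≡ true ⊎ ∃ λ w → Clash (σ w u) (σ w v)

  special? : ∀ {N} (σ : Labelling N) u v → Dec (Special σ u v)
  special? σ u v = (adjOf σ u v Bool.≟ true) ⊎-dec any? λ w → clash? (σ w u) (σ w v)

  is-just⇒just : ∀ {x : Maybe (Label m n)} → is-just x ≡ true → ∃ λ l → x ≡ just l
  is-just⇒just {just l} _ = l , refl

  -- Identifying adjacent vertices would create a loop in `H`; identifying the ends of a special
  -- 2-path would give one adjacency of `H` two labels.
  special⇒≢ : ∀ {N M} (G : MNGraph m n N) (H : MNGraph m n M) {f} → IsHom G H f →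
              ∀ {u v} → Special (σ G) u v → f u ≢ f v
  special⇒≢ G H {f} hom {u} {v} (inj₁ uv) fu≡fv with (l , eq) ← is-just⇒just uv =
    case trans (sym (hom u v l eq)) (trans (cong (λ x → σ H x (f v)) fu≡fv) (σ-irrefl H (f v))) of λ ()
  special⇒≢ G H {f} hom {u} {v} (inj₂ (w , c)) fu≡fv with σ G w u in wu | σ G w v in wv | c
  ... | just k | just l | clash k≢l = k≢l (just-injective
    (trans (sym (hom w u k wu)) (trans (cong (σ H (f w)) fu≡fv) (hom w v l wv))))

  module Quotient {N M : ℕ} (G : MNGraph m n N) (f : Fin N → Fin M)
    (separates : ∀ {a b} → f a ≡ f b → σ G a b ≡ nothing)
    (coherent : ∀ {a b a′ b′ l l′} → f a ≡ f a′ → f b ≡ f b′ →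
                σ G a b ≡ just l → σ G a′ b′ ≡ just l′ → l ≡ l′) where

    edge-over? : ∀ x y → Dec (∃ λ a → ∃ λ b → f a ≡ x × f b ≡ y × is-just (σ G a b) ≡ true)
    edge-over? x y = any? λ a → any? λ b → (f a ≟ x) ×-dec ((f b ≟ y) ×-dec (is-just (σ G a b) Bool.≟ true))

    -- Any adjacency of `G` over the pair may represent it, since `coherent` makes the label
    -- independent of the choice.
    label : Fin M → Fin M → Maybe (Label m n)
    label x y with edge-over? x y
    ... | yes (a , b , _) = σ G a b
    ... | no _            = nothing

    label-over : ∀ {a b l} → σ G a b ≡ just l → label (f a) (f b) ≡ just l
    label-over {a} {b} {l} ab with edge-over? (f a) (f b)
    ... | no none = contradiction (a , b , refl , refl , cong is-just ab) none
    ... | yes (a′ , b′ , fa , fb , a′b′) with (l′ , eq) ← is-just⇒just a′b′ =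
      trans eq (cong just (coherent fa fb eq ab))

    label-none : ∀ {x y} → (∀ a b → f a ≡ x → f b ≡ y → is-just (σ G a b) ≢ true) → label x y ≡ nothing
    label-none {x} {y} none with edge-over? x y
    ... | no _ = refl
    ... | yes (a , b , fa , fb , ab) = contradiction ab (none a b fa fb)

    quotient : MNGraph m n M
    quotient = record { σ = label ; σ-rev = rev ; σ-irrefl = irr }
      where
      rev : ∀ x y → label y x ≡ Maybe.map reverse (label x y)
      rev x y with edge-over? x y
      ... | no none = label-none λ b a fb fa ba → none
        (a , b , fa , fb , trans (cong is-just (σ-rev G b a)) (trans (is-just-map reverse (σ G b a)) ba))
      ... | yes (a , b , refl , refl , ab) with (l , eq) ← is-just⇒just ab =
        trans (label-over (trans (σ-rev G a b) (cong (Maybe.map reverse) eq))) (sym (cong (Maybe.map reverse) eq))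

      irr : ∀ x → label x x ≡ nothing
      irr x = label-none λ a b fa fb ab →
        case trans (sym ab) (cong is-just (separates (trans fa (sym fb)))) of λ ()

    quotient-hom : IsHom G quotient f
    quotient-hom u v l uv = label-over uv

  module Merge {N : ℕ} (G : MNGraph m n (suc N)) {u v : Fin (suc N)} (u≢v : u ≢ v) (¬special : ¬ Special (σ G) u v) where

    -- Sending `v` to `u` first keeps `v` out of the image, so that it can be punched out and one
    -- vertex is lost.
    redirect : Fin (suc N) → Fin (suc N)
    redirect w with w ≟ v
    ... | yes _ = u
    ... | no _  = w

    v≢redirect : ∀ w → v ≢ redirect w
    v≢redirect w with w ≟ v
    ... | yes _  = u≢v ∘ sym
    ... | no w≢v = w≢v ∘ sym

    merge : Fin (suc N) → Fin N
    merge w = punchOut (v≢redirect w)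

    data Same : Fin (suc N) → Fin (suc N) → Set where
      same : ∀ {w} → Same w w
      uv   : Same u v
      vu   : Same v u

    redirect-same : ∀ a b → redirect a ≡ redirect b → Same a b
    redirect-same a b eq with a ≟ v | b ≟ v
    redirect-same a b eq   | yes refl | yes refl = same
    redirect-same a b refl | yes refl | no _     = vu
    redirect-same a b refl | no _     | yes refl = uv
    redirect-same a b refl | no _     | no _     = same

    merge-same : ∀ {a b} → merge a ≡ merge b → Same a b
    merge-same {a} {b} eq = redirect-same a b (punchOut-injective (v≢redirect a) (v≢redirect b) eq)

    merge-uv : merge u ≡ merge v
    merge-uv = punchOut-cong v (trans redirect-u (sym redirect-v))
      where
      redirect-u : redirect u ≡ u
      redirect-u with u ≟ v
      ... | yes u≡v = contradiction u≡v u≢v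
      ... | no _    = refl
      redirect-v : redirect v ≡ u
      redirect-v with v ≟ v
      ... | yes _  = refl
      ... | no v≢v = contradiction refl v≢v

    non-adjacent : σ G u v ≡ nothing
    non-adjacent with σ G u v
    ... | nothing = refl
    ... | just l  = contradiction (inj₁ refl) ¬special

    separates : ∀ {a b} → Same a b → σ G a b ≡ nothing
    separates {a} same = σ-irrefl G a
    separates uv       = non-adjacent
    separates vu       = trans (σ-rev G u v) (cong (Maybe.map reverse) non-adjacent)

    agree : ∀ {w k l} → σ G w u ≡ just k → σ G w v ≡ just l → k ≡ l
    agree {w} {k} {l} wu wv = decidable-stable (k ≟ᴸ l) λ k≢l →
      ¬special (inj₂ (w , subst₂ Clash (sym wu) (sym wv) (clash k≢l)))

    agree-rev : ∀ {w k l} → σ G u w ≡ just k → σ G v w ≡ just l → k ≡ l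
    agree-rev {w} {k} {l} uw vw = trans (sym (reverse-involutive k))
      (trans (cong reverse (agree (flipped uw) (flipped vw))) (reverse-involutive l))
      where
      flipped : ∀ {a l} → σ G a w ≡ just l → σ G w a ≡ just (reverse l)
      flipped {a} aw = trans (σ-rev G a w) (cong (Maybe.map reverse) aw)

    clear : ∀ {a b l} {A : Set} → σ G a b ≡ just l → Same a b → A
    clear ab s = case trans (sym ab) (separates s) of λ ()

    -- If just one end changes between `u` and `v`, differing labels would form a special 2-path. If
    -- both ends change, the adjacency would lie inside the pair of `u` and `v`, where there is
    -- none.
    coherent : ∀ {a b a′ b′ l l′} → Same a a′ → Same b b′ → σ G a b ≡ just l → σ G a′ b′ ≡ just l′ → l ≡ l′
    coherent same same ab ab′ = just-injective (trans (sym ab) ab′)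
    coherent same uv   ab ab′ = agree ab ab′
    coherent same vu   ab ab′ = sym (agree ab′ ab)
    coherent uv   same ab ab′ = agree-rev ab ab′
    coherent vu   same ab ab′ = sym (agree-rev ab′ ab)
    coherent uv   uv   ab ab′ = clear ab same
    coherent uv   vu   ab ab′ = clear ab uv
    coherent vu   uv   ab ab′ = clear ab vu
    coherent vu   vu   ab ab′ = clear ab same

    open Quotient G merge (separates ∘ merge-same) (λ p q → coherent (merge-same p) (merge-same q)) public

  relativeClique⇒special : ∀ {N} (G : MNGraph m n N) R → IsRelativeClique G R →
                           ∀ u v → u ∈ R → v ∈ R → u ≢ v → Special (σ G) u v
  relativeClique⇒special {suc N} G R clique u v u∈R v∈R u≢v =
    decidable-stable (special? (σ G) u v) λ ¬special →
      let open Merge G u≢v ¬special in clique quotient merge quotient-hom u v u∈R v∈R u≢v merge-uv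

  special⇒relativeClique : ∀ {N} (G : MNGraph m n N) R →
    (∀ u v → u ∈ R → v ∈ R → u ≢ v → Special (σ G) u v) → IsRelativeClique G R
  special⇒relativeClique G R special H f hom u v u∈R v∈R u≢v = special⇒≢ G H hom (special u v u∈R v∈R u≢v)

  absoluteClique⇒special : ∀ {N} (A : MNGraph m n N) → IsAbsoluteClique A → ∀ u v → u ≢ v → Special (σ A) u v
  absoluteClique⇒special {suc N} A (_ , minimal) u v u≢v =
    decidable-stable (special? (σ A) u v) λ ¬special →
      -- The merged graph is a target with one vertex fewer, against the minimality of the chromatic
      -- number.
      let open Merge A u≢v ¬special in 1+n≰n (minimal N (quotient , merge , quotient-hom))

  -- Every homomorphism from `A` is injective, so no target is smaller than `A`; the identity
  -- attains this order.
  special⇒absoluteClique : ∀ {N} (A : MNGraph m n N) → (∀ u v → u ≢ v → Special (σ A) u v) → IsAbsoluteClique A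
  special⇒absoluteClique A special =
    (A , id , λ _ _ _ → id) ,
    λ M (H , f , hom) → injective⇒≤ {f = f} λ {u} {v} fu≡fv →
      decidable-stable (u ≟ v) λ u≢v → special⇒≢ A H hom (special u v u≢v) fu≡fv

-- Existence of the extremal orders

Exhaustible : Set → Set₁
Exhaustible A = ∀ {P : A → Set} → (∀ a → Dec (P a)) → Dec (∃ P)

exhaustible-Bool : Exhaustible Bool
exhaustible-Bool P? = map′ [ (false ,_) , (true ,_) ]′
  (λ { (false , p) → inj₁ p ; (true , p) → inj₂ p }) (P? false ⊎-dec P? true)

exhaustible-Label : ∀ {m n} → Exhaustible (Label m n)
exhaustible-Label {P = P} P? = map′ (λ (c , p) → decode c , p)
  (λ (l , p) → encode l , subst P (sym (decode-encode l)) p) (any? (P? ∘ decode))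

exhaustible-Maybe : ∀ {A} → Exhaustible A → Exhaustible (Maybe A)
exhaustible-Maybe search P? = map′ [ (nothing ,_) , (λ (a , p) → just a , p) ]′
  (λ { (nothing , p) → inj₁ p ; (just a , p) → inj₂ (a , p) }) (P? nothing ⊎-dec search (P? ∘ just))

exhaustible-Vec : ∀ {A} → Exhaustible A → ∀ n → Exhaustible (Vec A n)
exhaustible-Vec search zero    P? = map′ ([] ,_) (λ { ([] , p) → p }) (P? [])
exhaustible-Vec search (suc n) P? = map′ (λ (a , as , p) → a ∷ as , p) (λ { (a ∷ as , p) → a , as , p })
  (search λ a → exhaustible-Vec search n λ as → P? (a ∷ as))

-- The search runs over tables. A function agrees with its table only pointwise, hence the demand
-- that `Q` respect pointwise equality.
search-matrix : ∀ {A N} → Exhaustible A → {Q : (Fin N → Fin N → A) → Set} → (∀ f → Dec (Q f)) →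
                (∀ {f g} → (∀ u v → f u v ≡ g u v) → Q f → Q g) → Dec (∃ Q)
search-matrix {A} {N} search {Q} Q? resp = map′ (λ (M , q) → entries M , q)
  (λ (f , q) → tabulate (tabulate ∘ f) , resp (λ u v → sym (entries-tabulate f u v)) q)
  (exhaustible-Vec (exhaustible-Vec search N) N (Q? ∘ entries))
  where
  entries : Vec (Vec A N) N → Fin N → Fin N → A
  entries M u v = lookup (lookup M u) v

  entries-tabulate : ∀ f u v → entries (tabulate (tabulate ∘ f)) u v ≡ f u v
  entries-tabulate f u v =
    trans (cong (λ row → lookup row v) (lookup∘tabulate (tabulate ∘ f) u)) (lookup∘tabulate (f u) v)

-- The search goes down from the bound `B`, and `P 0` guarantees that it succeeds.
maximum : ∀ {P : ℕ → Set} → (∀ k → Dec (P k)) → P 0 → ∀ B → (∀ j → P j → j ≤ B) → ∃ (IsMax P)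
maximum P? P0 zero    bound = 0 , P0 , bound
maximum P? P0 (suc B) bound with P? (suc B)
... | yes p = suc B , p , bound
... | no ¬p = maximum P? P0 B λ j p → ≤-pred (≤∧≢⇒< (bound j p) λ { refl → ¬p p })

enum : ∀ {N} (S : Subset N) → Fin ∣ S ∣ → Fin N
enum (true  ∷ S) zero    = zero
enum (true  ∷ S) (suc i) = suc (enum S i)
enum (false ∷ S) i       = suc (enum S i)

enum-injective : ∀ {N} (S : Subset N) {i j} → enum S i ≡ enum S j → i ≡ j
enum-injective (true  ∷ S) {zero}  {zero}  eq = refl
enum-injective (true  ∷ S) {suc i} {suc j} eq = cong suc (enum-injective S (suc-injective eq))
enum-injective (false ∷ S)                 eq = enum-injective S (suc-injective eq)

enum-surjective : ∀ {N} (S : Subset N) {w} → lookup S w ≡ true → ∃ λ i → enum S i ≡ w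
enum-surjective (true  ∷ S) {zero}  _  = zero , refl
enum-surjective (true  ∷ S) {suc w} w∈ with (i , refl) ← enum-surjective S w∈ = suc i , refl
enum-surjective (false ∷ S) {suc w} w∈ with (i , refl) ← enum-surjective S w∈ = i , refl

sum-enum : ∀ {N} (S : Subset N) f → sum (f ∘ enum S) ≡ sum (λ w → ⟦ lookup S w ⟧ * f w)
sum-enum []          f = refl
sum-enum (true  ∷ S) f = cong₂ _+_ (sym (*-identityˡ (f zero))) (sum-enum S (f ∘ suc))
sum-enum (false ∷ S) f = sum-enum S (f ∘ suc)

degrees-resp : ∀ {N Δ} {adj adj′ : Fin N → Fin N → Bool} → (∀ u v → adj u v ≡ adj′ u v) →
               DegreesAtMost Δ adj → DegreesAtMost Δ adj′
degrees-resp same deg≤Δ v = subst (_≤ _) (sum-cong-≗ λ u → cong ⟦_⟧ (same v u)) (deg≤Δ v)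

-- Orders of graphs of diameter at most 2

module _ (Δ : ℕ) where

  -- Stated for a bare adjacency matrix and without distances, so that it is decidable and can be
  -- searched for.
  IsDiameter2 : ∀ {N} → (Fin N → Fin N → Bool) → Set
  IsDiameter2 adj = (∀ u v → adj v u ≡ adj u v) × (∀ u → adj u u ≡ false) ×
                    DegreesAtMost Δ adj × (∀ u v → u ≢ v → Near adj u v)

  isDiameter2? : ∀ {N} (adj : Fin N → Fin N → Bool) → Dec (IsDiameter2 adj)
  isDiameter2? adj =
    (all? λ u → all? λ v → adj v u Bool.≟ adj u v) ×-dec ((all? λ u → adj u u Bool.≟ false) ×-dec
    ((all? λ v → deg adj v ≤? Δ) ×-dec
    (all? λ u → all? λ v → ¬? (u ≟ v) →-dec
      ((adj u v Bool.≟ true) ⊎-dec any? λ w → (adj u w Bool.≟ true) ×-dec (adj w v Bool.≟ true)))))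

  isDiameter2-resp : ∀ {N} {f g : Fin N → Fin N → Bool} → (∀ u v → f u v ≡ g u v) → IsDiameter2 f → IsDiameter2 g
  isDiameter2-resp same (symm , irrefl , deg≤Δ , near) =
    (λ u v → trans (sym (same v u)) (trans (symm u v) (same u v))) ,
    (λ u → trans (sym (same u u)) (irrefl u)) ,
    degrees-resp same deg≤Δ ,
    λ u v u≢v → case near u v u≢v of λ
      { (inj₁ uv)            → inj₁ (trans (sym (same u v)) uv)
      ; (inj₂ (w , uw , wv)) → inj₂ (w , trans (sym (same u w)) uw , trans (sym (same w v)) wv)
      }

  Diameter2Order : ℕ → Set
  Diameter2Order k = Σ (Fin k → Fin k → Bool) IsDiameter2

  diameter2Order? : ∀ k → Dec (Diameter2Order k)
  diameter2Order? k = search-matrix exhaustible-Bool isDiameter2? isDiameter2-resp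

  diameter2Order-bound : ∀ k → Diameter2Order k → k ≤ Δ * Δ + 1
  diameter2Order-bound k (adj , symm , _ , deg≤Δ , near) =
    subst (_≤ Δ * Δ + 1) (trans (sum-const k 1) (*-identityʳ k))
      (moore-bound adj symm deg≤Δ (λ _ → true) λ u v _ _ → near u v)

  near⇒distance : ∀ {N} (G : Graph N) u v → (u ≢ v → Near (Graph.adj G) u v) →
                  ∃ λ k → Graph.IsDistance G u v k × k ≤ 2
  near⇒distance G u v near with u ≟ v | Graph.adj G u v in uv
  ... | yes refl | _    = 0 , (Graph.stop , λ _ _ → z≤n) , z≤n
  ... | no u≢v   | true = 1 , (Graph.step uv Graph.stop , atLeast1) , s≤s z≤n
    where
    atLeast1 : ∀ j → Graph.Walk G u v j → 1 ≤ j
    atLeast1 zero    Graph.stop = contradiction refl u≢v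
    atLeast1 (suc j) _          = s≤s z≤n
  ... | no u≢v   | false with near u≢v
  ...   | inj₂ (w , uw , wv) = 2 , (Graph.step uw (Graph.step wv Graph.stop) , atLeast2) , s≤s (s≤s z≤n)
    where
    atLeast2 : ∀ j → Graph.Walk G u v j → 2 ≤ j
    atLeast2 zero          Graph.stop                 = contradiction refl u≢v
    atLeast2 (suc zero)    (Graph.step uv′ Graph.stop) = case trans (sym uv) uv′ of λ ()
    atLeast2 (suc (suc j)) _                          = s≤s (s≤s z≤n)

  diameter⇒near : ∀ {N} (G : Graph N) → DiameterAtMost G 2 → ∀ u v → u ≢ v → Near (Graph.adj G) u v
  diameter⇒near G diam u v u≢v with diam u v
  ... | 0 , (Graph.stop , _) , _ = contradiction refl u≢v
  ... | 1 , (Graph.step uv Graph.stop , _) , _ = inj₁ uv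
  ... | 2 , (Graph.step uw (Graph.step wv Graph.stop) , _) , _ = inj₂ (_ , uw , wv)
  ... | suc (suc (suc _)) , _ , s≤s (s≤s ())

  isν : ∀ {k} → IsMax Diameter2Order k → Isν 2 Δ k
  isν ((adj , symm , irrefl , deg≤Δ , near) , maximal) =
    (G , (λ u v → near⇒distance G u v (near u v)) ,
     degrees⇒maxDegree G deg≤Δ) ,
    λ j (H , diam , max≤Δ) → maximal j
      (Graph.adj H , Graph.symm H , Graph.irrefl H , maxDegree⇒degrees H max≤Δ , diameter⇒near H diam)
    where
    G : Graph _
    G = record { adj = adj ; symm = symm ; irrefl = irrefl }

-- Orders of absolute and relative cliques

module _ {m n : ℕ} (Δ : ℕ) where

  -- The characterisation by special pairs, on a bare labelling, replaces the quantification over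
  -- all homomorphisms and makes the notion decidable. Taking `⊤` for `R` gives absolute cliques, so
  -- one search serves both kinds.
  IsClique : ∀ {N} → Subset N → Labelling {m} {n} N → Set
  IsClique R σ = (∀ u v → σ v u ≡ Maybe.map reverse (σ u v)) × (∀ u → σ u u ≡ nothing) ×
                 DegreesAtMost Δ (adjOf σ) × (∀ u v → u ∈ R → v ∈ R → u ≢ v → Special σ u v)

  isClique? : ∀ {N} R (σ : Labelling N) → Dec (IsClique R σ)
  isClique? R σ =
    (all? λ u → all? λ v → ≡-dec _≟ᴸ_ (σ v u) (Maybe.map reverse (σ u v))) ×-dec
    ((all? λ u → ≡-dec _≟ᴸ_ (σ u u) nothing) ×-dec
    ((all? λ v → deg (adjOf σ) v ≤? Δ) ×-dec
    (all? λ u → all? λ v → (u ∈? R) →-dec ((v ∈? R) →-dec (¬? (u ≟ v) →-dec special? σ u v)))))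

  isClique-resp : ∀ {N R} {f g : Labelling N} → (∀ u v → f u v ≡ g u v) → IsClique R f → IsClique R g
  isClique-resp same (rev , irr , deg≤Δ , special) =
    (λ u v → trans (sym (same v u)) (trans (rev u v) (cong (Maybe.map reverse) (same u v)))) ,
    (λ u → trans (sym (same u u)) (irr u)) ,
    degrees-resp (λ u v → cong is-just (same u v)) deg≤Δ ,
    λ u v u∈R v∈R u≢v → case special u v u∈R v∈R u≢v of λ
      { (inj₁ uv)      → inj₁ (trans (sym (cong is-just (same u v))) uv)
      ; (inj₂ (w , c)) → inj₂ (w , subst₂ Clash (same w u) (same w v) c)
      }

  clique? : ∀ {N} (R : Subset N) → Dec (∃ (IsClique R))
  clique? R = search-matrix (exhaustible-Maybe exhaustible-Label) (isClique? R) isClique-resp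

  AbsoluteOrder : ℕ → Set
  AbsoluteOrder k = ∃ (IsClique (⊤ {k}))

  RelativeOrder : ℕ → Set
  RelativeOrder k = ∃ λ N → ∃ λ (R : Subset N) → ∣ R ∣ ≡ k × ∃ (IsClique R)

  absolute⇒relative : ∀ {k} → AbsoluteOrder k → RelativeOrder k
  absolute⇒relative {k} clique = k , ⊤ , ∣⊤∣≡n k , clique

  toGraph : ∀ {N} {R : Subset N} → ∃ (IsClique R) → MNGraph m n N
  toGraph (σ , rev , irr , _) = record { σ = σ ; σ-rev = rev ; σ-irrefl = irr }

  clash⇒just : ∀ {x y : Maybe (Label m n)} → Clash x y → is-just x ≡ true
  clash⇒just (clash _) = refl

  special⇒near : ∀ {N} (G : MNGraph m n N) {u v} → Special (σ G) u v → Near (adjOf (σ G)) u v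
  special⇒near G (inj₁ uv) = inj₁ uv
  special⇒near G {u} {v} (inj₂ (w , c)) with σ G w u in wu | σ G w v in wv | c
  ... | just _ | just _ | clash _ =
    inj₂ (w , trans (Graph.symm (und G) w u) (cong is-just wu) , cong is-just wv)

  module _ {N : ℕ} (R : Subset N) (clique : ∃ (IsClique R)) where
    private
      G : MNGraph m n N
      G = toGraph clique

      deg≤Δ : DegreesAtMost Δ (adjOf (σ G))
      deg≤Δ = proj₁ (proj₂ (proj₂ (proj₂ clique)))

      special : ∀ u v → lookup R u ≡ true → lookup R v ≡ true → u ≢ v → Special (σ G) u v
      special u v ru rv = proj₂ (proj₂ (proj₂ (proj₂ clique))) u v (lookup⇒[]= u R ru) (lookup⇒[]= v R rv)

    clique-moore : ∣ R ∣ ≤ Δ * Δ + 1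
    clique-moore = subst (_≤ Δ * Δ + 1) (sym (∣S∣≡sum R))
      (moore-bound (adjOf (σ G)) (Graph.symm (und G)) deg≤Δ (lookup R)
        λ u v ru rv u≢v → special⇒near G (special u v ru rv u≢v))

    clique-label-bound : .{{_ : NonZero (2 * m + n)}} → ∣ R ∣ ≤ ((2 * m + n ∸ 1) * (Δ * Δ)) / (2 * m + n) + Δ + 1
    clique-label-bound = subst (_≤ _) (sym (∣S∣≡sum R))
      (label-bound t (λ u v → trans (justs v u) (trans (Graph.symm (und G) u v) (sym (justs u v))))
        (degrees-resp (λ u v → sym (justs u v)) deg≤Δ) (lookup R)
        λ u v ru rv u≢v → separated (special u v ru rv u≢v))
      where
      t : Fin N → Fin N → Maybe (Fin (2 * m + n))
      t u v = Maybe.map encode (σ G u v)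

      justs : ∀ u v → is-just (t u v) ≡ adjOf (σ G) u v
      justs u v = is-just-map encode (σ G u v)

      separated : ∀ {u v} → Special (σ G) u v → Separated t u v
      separated {u} {v} (inj₁ uv) = inj₁ (trans (justs u v) uv)
      separated {u} {v} (inj₂ (w , c)) with σ G w u in wu | σ G w v in wv | c
      ... | just k | just l | clash k≢l = inj₂ (w , encode k , encode l ,
        cong (Maybe.map encode) wu , cong (Maybe.map encode) wv , k≢l ∘ encode-injective)

    -- R together with its neighbourhood already witnesses that R is a relative clique.
    private
      inS? : ∀ w → Dec (lookup R w ≡ true ⊎ ∃ λ u → lookup R u ≡ true × adjOf (σ G) u w ≡ true)
      inS? w = (lookup R w Bool.≟ true) ⊎-dec any? λ u → (lookup R u Bool.≟ true) ×-dec (adjOf (σ G) u w Bool.≟ true)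

      S : Subset N
      S = tabulate (does ∘ inS?)

      S-complete : ∀ {w} → lookup R w ≡ true ⊎ (∃ λ u → lookup R u ≡ true × adjOf (σ G) u w ≡ true) → lookup S w ≡ true
      S-complete {w} w∈ = trans (lookup∘tabulate (does ∘ inS?) w) (dec-true (inS? w) w∈)

      e : Fin ∣ S ∣ → Fin N
      e = enum S

      R′ : Subset ∣ S ∣
      R′ = tabulate (lookup R ∘ e)

      ∣R′∣ : ∣ R′ ∣ ≡ ∣ R ∣
      ∣R′∣ = trans (∣tabulate∣≡sum (lookup R ∘ e)) (trans (sum-enum S (⟦_⟧ ∘ lookup R))
               (trans (sum-cong-≗ within) (sym (∣S∣≡sum R))))
        where
        within : ∀ w → ⟦ lookup S w ⟧ * ⟦ lookup R w ⟧ ≡ ⟦ lookup R w ⟧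
        within w with lookup R w in rw
        ... | false = *-zeroʳ ⟦ lookup S w ⟧
        ... | true rewrite S-complete (inj₁ rw) = refl

      ∣S∣≤ : ∣ S ∣ ≤ ∣ R ∣ + ∣ R ∣ * Δ
      ∣S∣≤ = begin
        ∣ S ∣                                               ≡⟨ ∣tabulate∣≡sum (does ∘ inS?) ⟩
        sum (λ w → 𝟙 (inS? w))                              ≤⟨ sum-mono count ⟩
        sum (λ w → ⟦ lookup R w ⟧ + sum (λ u → near u w))   ≡⟨ ∑-distrib-+ (⟦_⟧ ∘ lookup R) (λ w → sum (λ u → near u w)) ⟩
        sum (⟦_⟧ ∘ lookup R) + sum (λ w → sum (λ u → near u w)) ≡⟨ cong₂ _+_ (sym (∣S∣≡sum R)) (∑-comm (λ w u → near u w)) ⟩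
        ∣ R ∣ + sum (λ u → sum (near u))                    ≤⟨ +-monoʳ-≤ ∣ R ∣ (sum-mono row) ⟩
        ∣ R ∣ + sum (λ u → ⟦ lookup R u ⟧ * Δ)              ≡⟨ cong (∣ R ∣ +_) (*-distribʳ-sum Δ (⟦_⟧ ∘ lookup R)) ⟨
        ∣ R ∣ + sum (⟦_⟧ ∘ lookup R) * Δ                    ≡⟨ cong (λ k → ∣ R ∣ + k * Δ) (∣S∣≡sum R) ⟨
        ∣ R ∣ + ∣ R ∣ * Δ                                   ∎
        where
        open ≤-Reasoning
        near : Fin N → Fin N → ℕ
        near u w = ⟦ lookup R u ⟧ * ⟦ adjOf (σ G) u w ⟧

        row : ∀ u → sum (near u) ≤ ⟦ lookup R u ⟧ * Δ
        row u = ≤-trans (≤-reflexive (sym (*-distribˡ-sum ⟦ lookup R u ⟧ (λ w → ⟦ adjOf (σ G) u w ⟧))))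
                  (*-monoʳ-≤ ⟦ lookup R u ⟧ (deg≤Δ u))

        count : ∀ w → 𝟙 (inS? w) ≤ ⟦ lookup R w ⟧ + sum (λ u → near u w)
        count w = case inS? w of λ
          { (yes w∈) → ≤-trans (⟦⟧≤1 (does (inS? w))) (positive w∈)
          ; (no w∉)  → ≤-trans (≤-reflexive (𝟙-no (inS? w) w∉)) z≤n
          }
          where
          positive : lookup R w ≡ true ⊎ (∃ λ u → lookup R u ≡ true × adjOf (σ G) u w ≡ true) →
                     1 ≤ ⟦ lookup R w ⟧ + sum (λ u → near u w)
          positive (inj₁ rw) = ≤-trans (≤-reflexive (sym (cong ⟦_⟧ rw))) (m≤m+n _ _)
          positive (inj₂ (u , ru , uw)) =
            ≤-trans (≤-trans (≤-reflexive (sym (cong₂ (λ b c → ⟦ b ⟧ * ⟦ c ⟧) ru uw))) (term≤sum (λ u → near u w) u))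
              (m≤n+m _ ⟦ lookup R w ⟧)

      clique′ : IsClique R′ (λ u v → σ G (e u) (e v))
      clique′ =
        (λ u v → σ-rev G (e u) (e v)) ,
        (λ u → σ-irrefl G (e u)) ,
        (λ v → ≤-trans (≤-reflexive (sum-enum S (λ u → ⟦ adjOf (σ G) (e v) u ⟧)))
                 (≤-trans (sum-mono λ u → ⟦⟧*≤ (lookup S u) _) (deg≤Δ (e v)))) ,
        λ u v u∈ v∈ u≢v → lift (member u∈) (special (e u) (e v) (member u∈) (member v∈) (u≢v ∘ enum-injective S))
        where
        member : ∀ {u} → u ∈ R′ → lookup R (e u) ≡ true
        member {u} u∈ = trans (sym (lookup∘tabulate (lookup R ∘ e) u)) ([]=⇒lookup u∈)

        lift : ∀ {u v} → lookup R (e u) ≡ true → Special (σ G) (e u) (e v) → Special (λ u v → σ G (e u) (e v)) u v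
        lift ru (inj₁ uv) = inj₁ uv
        -- The centre `w` is adjacent to a member of `R` and therefore survives in `S`.
        lift {u} ru (inj₂ (w , c))
          with (i , refl) ← enum-surjective S (S-complete (inj₂ (e u , ru ,
                              trans (Graph.symm (und G) w (e u)) (clash⇒just c)))) = inj₂ (i , c)

    shrink : ∃ λ N′ → N′ < suc (∣ R ∣ + ∣ R ∣ * Δ) × ∃ λ (R′ : Subset N′) → ∣ R′ ∣ ≡ ∣ R ∣ × ∃ (IsClique R′)
    shrink = ∣ S ∣ , s≤s ∣S∣≤ , R′ , ∣R′∣ , _ , clique′

  absoluteOrder? : ∀ k → Dec (AbsoluteOrder k)
  absoluteOrder? k = clique? ⊤

  -- By `shrink` only graphs with at most k + k·Δ vertices need to be searched; `anyUpTo?` takes a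
  -- strict bound, hence the `suc`.
  relativeOrder? : ∀ k → Dec (RelativeOrder k)
  relativeOrder? k = map′ (λ (N , _ , found) → N , found) (λ { (N , R , refl , clique) → shrink R clique })
    (anyUpTo? (λ N → exhaustible-Vec exhaustible-Bool N λ R → (∣ R ∣ ≟ᴺ k) ×-dec clique? R) (suc (k + k * Δ)))

  relativeOrder-bound : ∀ k → RelativeOrder k → k ≤ Δ * Δ + 1
  relativeOrder-bound k (N , R , refl , clique) = clique-moore R clique

  -- The empty clique, the starting value that `maximum` asks for.
  trivial : AbsoluteOrder 0
  trivial = (λ ()) , (λ ()) , (λ ()) , (λ ()) , λ ()

  -- An absolute clique is its own largest clique subgraph, and a clique subgraph inherits the
  -- degree bound of its host. So the maximum over the family is the largest order of an absolute
  -- clique obeying the degree bound.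
  isωₐ : ∀ {k} → IsMax AbsoluteOrder k → OnFamily (ωₐ m n) (𝒢 Δ) k
  isωₐ {k} (clique@(σ′ , _ , _ , deg≤Δ , special) , maximal) =
    (k , A , degrees⇒maxDegree (und A) deg≤Δ ,
      (A , (id , id , λ _ _ _ → id) , special⇒absoluteClique A (λ u v → special u v ∈⊤ ∈⊤)) ,
      λ j (_ , (ι , inj , _) , _) → injective⇒≤ inj) ,
    λ j (N , G , max≤Δ , (B , (ι , inj , hom) , abs) , _) → maximal j
      (σ B , σ-rev B , σ-irrefl B ,
       (λ v → ≤-trans (sum-mono λ u → subgraph B G hom v u)
                (≤-trans (sum-injective-≤ inj (λ u → ⟦ adjOf (σ G) (ι v) u ⟧)) (maxDegree⇒degrees (und G) max≤Δ (ι v)))) ,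
       λ u v _ _ → absoluteClique⇒special B abs u v)
    where
    A : MNGraph m n k
    A = toGraph clique

    subgraph : ∀ {j N} (B : MNGraph m n j) (G : MNGraph m n N) {ι} → IsHom B G ι →
               ∀ v u → ⟦ adjOf (σ B) v u ⟧ ≤ ⟦ adjOf (σ G) (ι v) (ι u) ⟧
    subgraph B G hom v u with σ B v u in vu
    ... | nothing = z≤n
    ... | just l rewrite hom v u l vu = ≤-refl

  -- Every relative clique of a graph in the family is counted by `RelativeOrder`, so none exceeds
  -- `k`, in the extremal graph or in any other.
  isωᵣ : ∀ {k} → IsMax RelativeOrder k → OnFamily (ωᵣ m n) (𝒢 Δ) k
  isωᵣ {k} ((N , R , ∣R∣≡k , clique@(_ , _ , _ , deg≤Δ , special)) , maximal) =
    (N , G , degrees⇒maxDegree (und G) deg≤Δ ,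
      (R , special⇒relativeClique G R special , ∣R∣≡k) ,
      λ j (R′ , rel , ∣R′∣≡j) → maximal j (order G deg≤Δ R′ rel ∣R′∣≡j)) ,
    λ j (N′ , G′ , max≤Δ , (R′ , rel , ∣R′∣≡j) , _) →
      maximal j (order G′ (maxDegree⇒degrees (und G′) max≤Δ) R′ rel ∣R′∣≡j)
    where
    G : MNGraph m n N
    G = toGraph clique

    order : ∀ {N j} (G : MNGraph m n N) → DegreesAtMost Δ (adjOf (σ G)) → ∀ R →
            IsRelativeClique G R → ∣ R ∣ ≡ j → RelativeOrder j
    order {N} G deg≤Δ R rel ∣R∣≡j =
      N , R , ∣R∣≡j , σ G , σ-rev G , σ-irrefl G , deg≤Δ , relativeClique⇒special G R rel

  absolute⇒diameter2 : ∀ {k} → AbsoluteOrder k → Diameter2Order Δ k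
  absolute⇒diameter2 clique@(σ′ , _ , _ , deg≤Δ , special) =
    adjOf σ′ , Graph.symm (und A) , Graph.irrefl (und A) , deg≤Δ ,
    λ u v u≢v → special⇒near A (special u v ∈⊤ ∈⊤ u≢v)
    where
    A : MNGraph m n _
    A = toGraph clique

  -- Vizing's theorem needs Δ + 1 colours, and the `2 * m + n` labels supply them. In the oriented
  -- colouring every 2-path between distinct vertices is special, so distance at most 2 suffices.
  diameter2⇒absolute : Δ < 2 * m + n → ∀ {k} → Diameter2Order Δ k → AbsoluteOrder k
  diameter2⇒absolute Δ<p {k} (adj , symm , irrefl , deg≤Δ , near)
    with (C , total) ← Vizing.vizing {p = 2 * m + n} (record { adj = adj ; symm = symm ; irrefl = irrefl })
                         (λ u → ≤-<-trans (deg≤Δ u) Δ<p) =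
    σ H , σ-rev H , σ-irrefl H , degrees-resp (λ u v → sym (same u v)) deg≤Δ ,
    λ u v _ _ u≢v → case near u v u≢v of λ
      { (inj₁ uv)            → inj₁ (trans (same u v) uv)
      ; (inj₂ (w , uw , wv)) → inj₂ (w , distinct u≢v (trans (same w u) (trans (symm u w) uw)) (trans (same w v) wv))
      }
    where
    G : Graph k
    G = record { adj = adj ; symm = symm ; irrefl = irrefl }

    H : MNGraph m n k
    H = oriented G C

    same : ∀ u v → adjOf (σ H) u v ≡ adj u v
    same = oriented-und G C total

    distinct : ∀ {u v w} → u ≢ v → adjOf (σ H) w u ≡ true → adjOf (σ H) w v ≡ true → Clash (σ H w u) (σ H w v)
    distinct {u} {v} {w} u≢v wu wv
      with (k , wu′) ← is-just⇒just wu | (l , wv′) ← is-just⇒just wv =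
      subst₂ Clash (sym wu′) (sym wv′) (clash λ { refl → u≢v (oriented-proper G C {w} wu′ wv′) })

-- The three ranges of the maximum degree

theorem3p1 : (m n : ℕ) .{{_ : NonZero (2 * m + n)}} → (m , n) ≢ (0 , 1) → (Δ : ℕ) →
    ∃ λ ν → ∃ λ a → ∃ λ r →
    Isν 2 Δ ν × OnFamily (ωₐ m n) (𝒢 Δ) a × OnFamily (ωᵣ m n) (𝒢 Δ) r ×
    (Δ < 2 * m + n → ν ≡ a × a ≤ r × r ≤ Δ ^ 2 + 1) ×
    (Δ ≡ 2 * m + n → a ≤ r × r ≤ Δ ^ 2 + 1) ×
    (Δ > 2 * m + n →
    a ≤ r × r ≤ ((2 * m + n ∸ 1) * Δ ^ 2) / (2 * m + n) + Δ + 1)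
theorem3p1 m n _ Δ
  with (ν , νmax@(νgraph , ν-largest)) ← maximum (diameter2Order? Δ)
         (absolute⇒diameter2 {m} {n} Δ (trivial Δ)) _ (diameter2Order-bound Δ)
     | (a , amax@(aclique , a-largest)) ← maximum (absoluteOrder? {m} {n} Δ)
         (trivial Δ) _ (λ k → relativeOrder-bound Δ k ∘ absolute⇒relative Δ)
     | (r , rmax@(rclique , r-largest)) ← maximum (relativeOrder? {m} {n} Δ)
         (absolute⇒relative Δ (trivial Δ)) _ (relativeOrder-bound Δ) =
  ν , a , r , isν Δ νmax , isωₐ Δ amax , isωᵣ Δ rmax ,
  -- An absolute clique has diameter at most 2, which bounds `a` by `ν`; the other direction labels
  -- an extremal graph of diameter at most 2 by way of Vizing's theorem.
  (λ Δ<p → ≤-antisym (a-largest ν (diameter2⇒absolute Δ Δ<p νgraph)) (ν-largest a (absolute⇒diameter2 Δ aclique)) ,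
           a≤r , r≤moore) ,
  (λ _ → a≤r , r≤moore) ,
  (λ _ → a≤r , subst (λ d → r ≤ ((2 * m + n ∸ 1) * d) / (2 * m + n) + Δ + 1) (sym Δ²) (label rclique))
  where
  Δ² : Δ ^ 2 ≡ Δ * Δ
  Δ² = cong (Δ *_) (*-identityʳ Δ)

  a≤r : a ≤ r
  a≤r = r-largest a (absolute⇒relative Δ aclique)

  r≤moore : r ≤ Δ ^ 2 + 1
  r≤moore = subst (λ d → r ≤ d + 1) (sym Δ²) (relativeOrder-bound Δ r rclique)

  label : RelativeOrder {m} {n} Δ r → r ≤ ((2 * m + n ∸ 1) * (Δ * Δ)) / (2 * m + n) + Δ + 1
  label (N , R , ∣R∣≡r , clique) = subst (_≤ _) ∣R∣≡r (clique-label-bound Δ R clique)
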